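{- For every integer $m\geq 1$ and every integer $n\geq m(3m+1)/2$, with all congruences taken modulo $M=3(2m+1)^2$, \[ \begin{aligned} 0 &= p\big(n\mid \text{parts}\not\equiv 0,\,(2m+1)(3m+1),\,(2m+1)(3m+2)\big) \\ &\quad+\sum_{i=1}^m (-1)^i\Big[\,p\Big(n-\tfrac{i(3i-1)}{2}\;\Big|\; \text{parts}\not\equiv 0,\,(2m+1)(3m-3i+2),\,(2m+1)(3m+3i+1)\Big) \\ &\qquad\qquad\qquad + p\Big(n-\tfrac{i(3i+1)}{2}\;\Big|\; \text{parts}\not\equiv 0,\,(2m+1)(3m-3i+1),\,(2m+1)(3m+3i+2)\Big)\Big]. \end{aligned} \]
   Context: A partition of a non-negative integer $N$ is a way of writing $N$ as a sum of positive integers (parts), where order of the parts does not matter; the integer $0$ has exactly one partition (the empty one). For integers $a,b,c$ and a modulus $M\geq 1$, $p(N\mid \text{parts}\not\equiv a,b,c \pmod{M})$ denotes the number of partitions of $N$ in which no part is congruent to $a$, $b$, or $c$ modulo $M$. -}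

module Defs where

open import Data.Nat using (ℕ; zero; suc; _+_; _*_; _∸_; _≤ᵇ_; _≡ᵇ_; _^_; NonZero)
open import Data.Nat.DivMod using (_%_)
open import Data.Bool using (Bool; true; false; if_then_else_; _∧_; not)
open import Data.List using (List; []; _∷_; _++_; map; concatMap; filterᵇ; length; upTo; replicate)
open import Data.Bool.ListAction using (all)
open import Data.Nat.Properties using (+-comm; m*n≢0)
open import Relation.Binary.PropositionalEquality using (subst; sym)
open import Data.Integer as ℤ using (ℤ; +_)

-- All partitions of n whose parts are all ≤ k, each listed exactly once
-- as the list of its parts in non-increasing order.  A partition with parts ≤ suc k
-- is determined by the multiplicity c of the part (suc k) together with a
-- partition of n - c·(suc k) into parts ≤ k.
partitionsLE : ℕ → ℕ → List (List ℕ)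
partitionsLE zero    n = if n ≡ᵇ 0 then [] ∷ [] else []
partitionsLE (suc k) n =
  concatMap (λ c → map (replicate c (suc k) ++_) (partitionsLE k (n ∸ c * suc k)))
            (filterᵇ (λ c → c * suc k ≤ᵇ n) (upTo (suc n)))

-- All partitions of n (every part of a partition of n is ≤ n).
partitions : ℕ → List (List ℕ)
partitions n = partitionsLE n n

pNot : (M : ℕ) .{{_ : NonZero M}} → ℕ → ℕ → ℕ → ℕ → ℕ
pNot M a b c N =
  length (filterᵇ (all (λ x → not (x % M ≡ᵇ a % M)
                            ∧ not (x % M ≡ᵇ b % M)
                            ∧ not (x % M ≡ᵇ c % M)))
                  (partitions N))

sumFrom1 : ℕ → (ℕ → ℤ) → ℤ
sumFrom1 zero    f = + 0
sumFrom1 (suc m) f = sumFrom1 m f ℤ.+ f (suc m)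

modulusNonZero : ∀ m → NonZero (3 * (2 * m + 1) ^ 2)
modulusNonZero m = m*n≢0 3 ((2 * m + 1) ^ 2) {{three}} {{sq}}
  where
  three : NonZero 3
  three = _
  one : NonZero (1 + 2 * m)
  one = _
  odd : NonZero (2 * m + 1)
  odd = subst NonZero (+-comm 1 (2 * m)) one
  sq : NonZero ((2 * m + 1) ^ 2)
  sq = m*n≢0 (2 * m + 1) ((2 * m + 1) ^ 1) {{odd}} {{m*n≢0 (2 * m + 1) 1 {{odd}} {{three'}}}}
    where
    three' : NonZero 1
    three' = _

{-# OPTIONS --safe #-}
module Submission where

-- Let k = 2m + 1, M = 3k² and ω(i) = i(3i + 1)/2.  Splitting Euler's pentagonal series Σ (-1)ⁿ q^ω(n) by the
-- residue i of n modulo k (|i| ≤ m) gives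
--   ∏ (1 - qⁿ) = Σ_i (-1)ⁱ q^ω(i) θ_i,   θ_i = Σ_j (-1)ʲ q^(a T(j) + b T(-j)),
-- where T(j) = j(j + 1)/2, a = k(3(m + i) + 2) and b = k(3(m - i) + 1).  As a + b = M, the triple product identity
-- turns θ_i into the product of 1 - qⁿ over n ≡ 0, a, b (mod M), so θ_i / ∏ (1 - qⁿ) is the generating function of
-- the partitions without such parts.  Dividing by ∏ (1 - qⁿ) leaves 1 on the left, whose positive coefficients vanish.
-- All series are truncated, so q is nilpotent; then every 1 - qⁿ (n > 0) is a unit, and the triple product is the
-- exact finite identity of Cauchy, in which the Gaussian binomials disappear once multiplied by ∏ (1 - Q^n).

open import Defs
open import Algebra.Bundles using (CommutativeRing; RawRing)
import Algebra.Properties.CommutativeSemiring.Exp as CommExp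
import Algebra.Properties.Ring as RingProperties
import Algebra.Properties.Semiring.Exp as Exp
import Algebra.Properties.Semiring.Mult.TCOptimised as Mult
import Algebra.Solver.Ring as RingSolver
open import Algebra.Solver.Ring.AlmostCommutativeRing using (_-Raw-AlmostCommutative⟶_; fromCommutativeRing)
open import Data.Bool using (Bool; true; false; if_then_else_; _∧_; not)
open import Data.Bool.ListAction using (all)
open import Data.Empty using (⊥-elim)
open import Data.Integer as ℤ using (ℤ; +_; -[1+_]; 0ℤ; 1ℤ; -1ℤ; _⊖_)
import Data.Integer.Properties as ℤₚ
import Data.Integer.Solver as ℤSolver
open import Data.List using (List; []; _∷_; _++_; map; concatMap; filterᵇ; length; applyUpTo; replicate)
import Data.List.Properties as Listₚ
open import Data.Maybe.Base using (Maybe; just; nothing)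
open import Data.Nat as ℕ using (ℕ; zero; suc; _<_; _≤_; z≤n; s≤s; _≡ᵇ_; _≤ᵇ_; NonZero)
open import Data.Nat.DivMod using (_/_; _%_; [m+kn]%n≡m%n; m<n⇒m%n≡m; n%n≡0; m*n/n≡m; /-monoˡ-≤)
import Data.Nat.Properties as ℕₚ
import Data.Nat.Solver as ℕSolver
open import Data.Product using (_,_; ∃)
open import Data.Sum using (_⊎_; inj₁; inj₂)
open import Function using (_∘_)
open import Level using (0ℓ)
open import Relation.Binary.PropositionalEquality as ≡ using (_≡_; _≢_; _≗_)
open import Relation.Nullary using (yes; no)

open ℕSolver.+-*-Solver using () renaming (solve to solveℕ; con to conℕ; _:+_ to _+ⁿ_; _:*_ to _*ⁿ_; _:=_ to _=ⁿ_)
open ℤSolver.+-*-Solver using () renaming (solve to solveℤ; con to conℤ; _:+_ to _+ᶻ_; _:*_ to _*ᶻ_; _:-_ to _-ᶻ_; :-_ to -ᶻ_; _:=_ to _=ᶻ_)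

-- The theta series is therefore kept in the symmetric form (-1)^j x^T(j) y^T(-j) with Q = xy, whose
-- exponents are all natural, and the ratio of consecutive terms is used only in a form cleared of
-- negative powers of Q.
--
-- One truncation order L = n + 1 serves throughout, and the Euler product runs over the parts up to
-- L M. This number is a multiple of M and of 3, so the same product splits into whole blocks both
-- for the triple product modulo M and for the pentagonal series modulo 3; it also exceeds n, so no
-- partition of n is lost.
--
-- The triple product has separate factors for a and b, whereas a residue listed twice is forbidden
-- only once; so a ≠ b has to be known, and it follows modulo 3 after cancelling k. The bound on n
-- keeps every shift ω(i) with |i| ≤ m at most n, so that truncated subtraction agrees with
-- extraction of coefficients, and with m ≥ 1 it makes n positive.

module IntegerCoefficients {c ℓ} (R : CommutativeRing c ℓ) where
  open CommutativeRing R hiding (zero)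
  open RingProperties ring
  open Mult semiring
  open import Relation.Binary.Reasoning.Setoid setoid

  -- Integers serve as solver coefficients because their equality is decidable. With the optimised
  -- multiple, `1 × 1#` reduces to `1#`, so `con (+ 1)` matches `1#` in goals definitionally.
  fromℤ : ℤ → Carrier
  fromℤ (+ n)    = n × 1#
  fromℤ -[1+ n ] = - (suc n × 1#)

  fromℤ-⊖ : ∀ m n → fromℤ (m ⊖ n) ≈ m × 1# + - (n × 1#)
  fromℤ-⊖ m zero = sym (trans (+-congˡ -0#≈0#) (+-identityʳ _))
  fromℤ-⊖ zero (suc n) = sym (+-identityˡ _)
  fromℤ-⊖ (suc m) (suc n) = begin
    fromℤ (suc m ⊖ suc n)                       ≡⟨ ≡.cong fromℤ (ℤₚ.[1+m]⊖[1+n]≡m⊖n m n) ⟩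
    fromℤ (m ⊖ n)                               ≈⟨ fromℤ-⊖ m n ⟩
    u + - v                                     ≈⟨ +-identityˡ _ ⟨
    0# + (u + - v)                              ≈⟨ +-congʳ (-‿inverseʳ 1#) ⟨
    1# + - 1# + (u + - v)                       ≈⟨ +-assoc _ _ _ ⟩
    1# + (- 1# + (u + - v))                     ≈⟨ +-congˡ (trans (sym (+-assoc _ _ _)) (trans (+-congʳ (+-comm _ _)) (+-assoc _ _ _))) ⟩
    1# + (u + (- 1# + - v))                     ≈⟨ +-assoc _ _ _ ⟨
    1# + u + (- 1# + - v)                       ≈⟨ +-congˡ (-‿+-comm 1# v) ⟩
    1# + u + - (1# + v)                         ≈⟨ +-cong (1+× m 1#) (-‿cong (1+× n 1#)) ⟨
    suc m × 1# + - (suc n × 1#)                 ∎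
    where
    u = m × 1#
    v = n × 1#

  fromℤ-neg : ∀ i → fromℤ (ℤ.- i) ≈ - fromℤ i
  fromℤ-neg (+ zero)  = sym -0#≈0#
  fromℤ-neg (+ suc n) = refl
  fromℤ-neg -[1+ n ]  = sym (-‿involutive _)

  fromℤ-+ : ∀ i j → fromℤ (i ℤ.+ j) ≈ fromℤ i + fromℤ j
  fromℤ-+ (+ m)    (+ n)    = ×-homo-+ 1# m n
  fromℤ-+ (+ m)    -[1+ n ] = fromℤ-⊖ m (suc n)
  fromℤ-+ -[1+ m ] (+ n)    = trans (fromℤ-⊖ n (suc m)) (+-comm _ _)
  fromℤ-+ -[1+ m ] -[1+ n ] = begin
    - (suc (suc (m ℕ.+ n)) × 1#)          ≡⟨ ≡.cong (λ t → - (t × 1#)) (≡.cong suc (≡.sym (ℕₚ.+-suc m n))) ⟩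
    - ((suc m ℕ.+ suc n) × 1#)            ≈⟨ -‿cong (×-homo-+ 1# (suc m) (suc n)) ⟩
    - (suc m × 1# + suc n × 1#)           ≈⟨ -‿+-comm _ _ ⟨
    - (suc m × 1#) + - (suc n × 1#)       ∎

  fromℤ-+*+ : ∀ m n → fromℤ (+ m ℤ.* + n) ≈ fromℤ (+ m) * fromℤ (+ n)
  fromℤ-+*+ m n = trans (reflexive (≡.cong fromℤ (≡.sym (ℤₚ.pos-* m n)))) (×1-homo-* m n)

  fromℤ-* : ∀ i j → fromℤ (i ℤ.* j) ≈ fromℤ i * fromℤ j
  fromℤ-* (+ m) (+ n) = fromℤ-+*+ m n
  fromℤ-* (+ m) -[1+ n ] = begin
    fromℤ (+ m ℤ.* (ℤ.- (+ suc n)))    ≡⟨ ≡.cong fromℤ (≡.sym (ℤₚ.neg-distribʳ-* (+ m) (+ suc n))) ⟩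
    fromℤ (ℤ.- (+ m ℤ.* + suc n))      ≈⟨ fromℤ-neg (+ m ℤ.* + suc n) ⟩
    - fromℤ (+ m ℤ.* + suc n)          ≈⟨ -‿cong (fromℤ-+*+ m (suc n)) ⟩
    - (m × 1# * suc n × 1#)            ≈⟨ -‿distribʳ-* _ _ ⟩
    m × 1# * - (suc n × 1#)            ∎
  fromℤ-* -[1+ m ] (+ n) = begin
    fromℤ (ℤ.- (+ suc m) ℤ.* + n)      ≡⟨ ≡.cong fromℤ (≡.sym (ℤₚ.neg-distribˡ-* (+ suc m) (+ n))) ⟩
    fromℤ (ℤ.- (+ suc m ℤ.* + n))      ≈⟨ fromℤ-neg (+ suc m ℤ.* + n) ⟩
    - fromℤ (+ suc m ℤ.* + n)          ≈⟨ -‿cong (fromℤ-+*+ (suc m) n) ⟩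
    - (suc m × 1# * n × 1#)            ≈⟨ -‿distribˡ-* _ _ ⟩
    - (suc m × 1#) * n × 1#            ∎
  fromℤ-* -[1+ m ] -[1+ n ] = begin
    fromℤ (+ suc m ℤ.* + suc n)        ≈⟨ fromℤ-+*+ (suc m) (suc n) ⟩
    u * v                              ≈⟨ -‿involutive _ ⟨
    - - (u * v)                        ≈⟨ -‿cong (-‿distribˡ-* u v) ⟩
    - (- u * v)                        ≈⟨ -‿distribʳ-* _ _ ⟩
    - u * - v                          ∎
    where
    u = suc m × 1#
    v = suc n × 1#

  ℤ-rawRing : RawRing _ _
  ℤ-rawRing = CommutativeRing.rawRing ℤₚ.+-*-commutativeRing

  fromℤ-morphism : ℤ-rawRing -Raw-AlmostCommutative⟶ fromCommutativeRing R
  fromℤ-morphism = record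
    { ⟦_⟧    = fromℤ
    ; +-homo = fromℤ-+
    ; *-homo = fromℤ-*
    ; -‿homo = fromℤ-neg
    ; 0-homo = refl
    ; 1-homo = refl
    }

  fromℤ-≟ : ∀ i j → Maybe (fromℤ i ≈ fromℤ j)
  fromℤ-≟ i j with i ℤ.≟ j
  ... | yes i≡j = just (reflexive (≡.cong fromℤ i≡j))
  ... | no _    = nothing

  module Solver = RingSolver ℤ-rawRing (fromCommutativeRing R) fromℤ-morphism fromℤ-≟

-- Finite sums and products: blocks, symmetric ranges, diagonals

module Sums {c ℓ} (R : CommutativeRing c ℓ) where
  open CommutativeRing R hiding (zero)
  open IntegerCoefficients R
  open Solver using (solve; _:=_; _:+_; _:*_)
  open import Relation.Binary.Reasoning.Setoid setoid

  1--cong : ∀ {u v} → u ≈ v → 1# - u ≈ 1# - v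
  1--cong u≈v = +-congˡ (-‿cong u≈v)

  Σ< : ℕ → (ℕ → Carrier) → Carrier
  Σ< zero    f = 0#
  Σ< (suc n) f = Σ< n f + f n

  Π< : ℕ → (ℕ → Carrier) → Carrier
  Π< zero    f = 1#
  Π< (suc n) f = Π< n f * f n

  Σ<-cong : ∀ n {f g : ℕ → Carrier} → (∀ i → i < n → f i ≈ g i) → Σ< n f ≈ Σ< n g
  Σ<-cong zero    h = refl
  Σ<-cong (suc n) h = +-cong (Σ<-cong n (λ i i<n → h i (ℕₚ.m<n⇒m<1+n i<n))) (h n ℕₚ.≤-refl)

  Π<-cong : ∀ n {f g : ℕ → Carrier} → (∀ i → i < n → f i ≈ g i) → Π< n f ≈ Π< n g
  Π<-cong zero    h = refl
  Π<-cong (suc n) h = *-cong (Π<-cong n (λ i i<n → h i (ℕₚ.m<n⇒m<1+n i<n))) (h n ℕₚ.≤-refl)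

  Σ<-distribˡ : ∀ n u f → u * Σ< n f ≈ Σ< n (λ i → u * f i)
  Σ<-distribˡ zero    u f = zeroʳ u
  Σ<-distribˡ (suc n) u f = trans (distribˡ u _ _) (+-congʳ (Σ<-distribˡ n u f))

  Σ<-0 : ∀ n → Σ< n (λ _ → 0#) ≈ 0#
  Σ<-0 zero    = refl
  Σ<-0 (suc n) = trans (+-identityʳ _) (Σ<-0 n)

  Π<-1 : ∀ n → Π< n (λ _ → 1#) ≈ 1#
  Π<-1 zero    = refl
  Π<-1 (suc n) = trans (*-identityʳ _) (Π<-1 n)

  Σ<-+ : ∀ n f g → Σ< n (λ i → f i + g i) ≈ Σ< n f + Σ< n g
  Σ<-+ zero    f g = sym (+-identityʳ 0#)
  Σ<-+ (suc n) f g = trans (+-congʳ (Σ<-+ n f g))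
    (solve 4 (λ a b u v → (a :+ b) :+ (u :+ v) := (a :+ u) :+ (b :+ v)) refl _ _ _ _)

  Π<-* : ∀ n f g → Π< n (λ i → f i * g i) ≈ Π< n f * Π< n g
  Π<-* zero    f g = sym (*-identityʳ 1#)
  Π<-* (suc n) f g = trans (*-congʳ (Π<-* n f g))
    (solve 4 (λ a b u v → (a :* b) :* (u :* v) := (a :* u) :* (b :* v)) refl _ _ _ _)

  Σ<-head : ∀ n f → Σ< (suc n) f ≈ f 0 + Σ< n (λ i → f (suc i))
  Σ<-head zero    f = +-comm 0# (f 0)
  Σ<-head (suc n) f = trans (+-congʳ (Σ<-head n f)) (+-assoc _ _ _)

  Σ<-++ : ∀ m n f → Σ< (m ℕ.+ n) f ≈ Σ< m f + Σ< n (λ i → f (m ℕ.+ i))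
  Σ<-++ m zero f rewrite ℕₚ.+-identityʳ m = sym (+-identityʳ _)
  Σ<-++ m (suc n) f rewrite ℕₚ.+-suc m n = trans (+-congʳ (Σ<-++ m n f)) (+-assoc _ _ _)

  Π<-++ : ∀ m n f → Π< (m ℕ.+ n) f ≈ Π< m f * Π< n (λ i → f (m ℕ.+ i))
  Π<-++ m zero f rewrite ℕₚ.+-identityʳ m = sym (*-identityʳ _)
  Π<-++ m (suc n) f rewrite ℕₚ.+-suc m n = trans (*-congʳ (Π<-++ m n f)) (*-assoc _ _ _)

  Σ<-blocks : ∀ k n f → Σ< (n ℕ.* k) f ≈ Σ< n (λ j → Σ< k (λ r → f (j ℕ.* k ℕ.+ r)))
  Σ<-blocks k zero    f = refl
  Σ<-blocks k (suc n) f rewrite ℕₚ.+-comm k (n ℕ.* k) =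
    trans (Σ<-++ (n ℕ.* k) k f) (+-congʳ (Σ<-blocks k n f))

  Π<-blocks : ∀ k n f → Π< (n ℕ.* k) f ≈ Π< n (λ j → Π< k (λ r → f (j ℕ.* k ℕ.+ r)))
  Π<-blocks k zero    f = refl
  Π<-blocks k (suc n) f rewrite ℕₚ.+-comm k (n ℕ.* k) =
    trans (Π<-++ (n ℕ.* k) k f) (*-congʳ (Π<-blocks k n f))

  Σ<-swap : ∀ m n (f : ℕ → ℕ → Carrier) →
    Σ< m (λ i → Σ< n (λ j → f i j)) ≈ Σ< n (λ j → Σ< m (λ i → f i j))
  Σ<-swap zero    n f = sym (Σ<-0 n)
  Σ<-swap (suc m) n f = trans (+-congʳ (Σ<-swap m n f)) (sym (Σ<-+ n _ _))

  -- The range -n ≤ j ≤ n shifted to start at 0, so that the block and exchange laws of `Σ<` apply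
  -- to it.
  Σ± : ℕ → (ℤ → Carrier) → Carrier
  Σ± n f = Σ< (suc (n ℕ.+ n)) (λ t → f (t ⊖ n))

  Σ±-zero : ∀ f → Σ± 0 f ≈ f (+ 0)
  Σ±-zero f = +-identityˡ _

  Σ±-suc : ∀ n f → Σ± (suc n) f ≈ Σ± n f + (f -[1+ n ] + f (+ suc n))
  Σ±-suc n f = begin
    Σ< (suc (n ℕ.+ suc n)) g + g (suc (n ℕ.+ suc n))
      ≡⟨ ≡.cong (λ t → Σ< (suc t) g + f (suc t ⊖ suc n)) (ℕₚ.+-suc n n) ⟩
    Σ< (suc (suc (n ℕ.+ n))) g + f (suc (suc (n ℕ.+ n)) ⊖ suc n)
      ≈⟨ +-cong (Σ<-head (suc (n ℕ.+ n)) g) (reflexive (≡.cong f top)) ⟩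
    (f -[1+ n ] + Σ< (suc (n ℕ.+ n)) (λ i → g (suc i))) + f (+ suc n)
      ≈⟨ +-congʳ (+-congˡ (Σ<-cong (suc (n ℕ.+ n)) (λ i _ → reflexive (≡.cong f (ℤₚ.[1+m]⊖[1+n]≡m⊖n i n))))) ⟩
    (f -[1+ n ] + Σ± n f) + f (+ suc n)
      ≈⟨ solve 3 (λ a b d → (a :+ b) :+ d := b :+ (a :+ d)) refl _ _ _ ⟩
    Σ± n f + (f -[1+ n ] + f (+ suc n)) ∎
    where
    g : ℕ → Carrier
    g t = f (t ⊖ suc n)
    top : suc (suc (n ℕ.+ n)) ⊖ suc n ≡ + suc n
    top = ≡.trans (ℤₚ.⊖-≥ {suc (suc (n ℕ.+ n))} {suc n} (s≤s (ℕₚ.m≤n⇒m≤1+n (ℕₚ.m≤m+n n n))))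
      (≡.cong +_ (≡.trans (≡.cong (ℕ._∸ n) (≡.sym (ℕₚ.+-suc n n))) (ℕₚ.m+n∸m≡n n (suc n))))

  -- Reconciles the different windows over which the triple product and the dissection sum the same
  -- series.
  Σ±-stable : ∀ L f → (∀ j → L ≤ ℤ.∣ j ∣ → f j ≈ 0#) → ∀ d → Σ± (L ℕ.+ d) f ≈ Σ± L f
  Σ±-stable L f vanish zero rewrite ℕₚ.+-identityʳ L = refl
  Σ±-stable L f vanish (suc d) rewrite ℕₚ.+-suc L d = begin
    Σ± (suc (L ℕ.+ d)) f                          ≈⟨ Σ±-suc (L ℕ.+ d) f ⟩
    Σ± (L ℕ.+ d) f + (f -[1+ L ℕ.+ d ] + f (+ suc (L ℕ.+ d)))
      ≈⟨ +-cong (Σ±-stable L f vanish d) (+-cong (vanish _ L≤) (vanish _ L≤)) ⟩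
    Σ± L f + (0# + 0#)                            ≈⟨ trans (+-congˡ (+-identityʳ 0#)) (+-identityʳ _) ⟩
    Σ± L f                                        ∎
    where
    L≤ : L ≤ suc (L ℕ.+ d)
    L≤ = ℕₚ.m≤n⇒m≤1+n (ℕₚ.m≤m+n L d)

  -- Every integer of absolute value at most (2m+1)J + m is uniquely (2m+1)j + i with |j| ≤ J and |i| ≤ m.
  Σ±-dissect : ∀ m J f →
    Σ± (J ℕ.* suc (m ℕ.+ m) ℕ.+ m) f ≈ Σ± m (λ i → Σ± J (λ j → f (j ℤ.* + suc (m ℕ.+ m) ℤ.+ i)))
  Σ±-dissect m J f = begin
    Σ< (suc (K ℕ.+ K)) (λ t → f (t ⊖ K))
      ≡⟨ ≡.cong (λ N → Σ< N (λ t → f (t ⊖ K)))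
           (solveℕ 2 (λ m J → conℕ 1 +ⁿ ((J *ⁿ (conℕ 1 +ⁿ (m +ⁿ m)) +ⁿ m) +ⁿ (J *ⁿ (conℕ 1 +ⁿ (m +ⁿ m)) +ⁿ m))
                              =ⁿ (conℕ 1 +ⁿ (J +ⁿ J)) *ⁿ (conℕ 1 +ⁿ (m +ⁿ m))) ≡.refl m J) ⟩
    Σ< (suc (J ℕ.+ J) ℕ.* k) (λ t → f (t ⊖ K))
      ≈⟨ Σ<-blocks k (suc (J ℕ.+ J)) _ ⟩
    Σ< (suc (J ℕ.+ J)) (λ s → Σ< k (λ r → f ((s ℕ.* k ℕ.+ r) ⊖ K)))
      ≈⟨ Σ<-swap (suc (J ℕ.+ J)) k _ ⟩
    Σ< k (λ r → Σ< (suc (J ℕ.+ J)) (λ s → f ((s ℕ.* k ℕ.+ r) ⊖ K)))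
      ≈⟨ Σ<-cong k (λ r _ → Σ<-cong (suc (J ℕ.+ J)) (λ s _ → reflexive (≡.cong f (index s r)))) ⟩
    Σ< k (λ r → Σ< (suc (J ℕ.+ J)) (λ s → f ((s ⊖ J) ℤ.* + k ℤ.+ (r ⊖ m)))) ∎
    where
    k = suc (m ℕ.+ m)
    K = J ℕ.* k ℕ.+ m
    cast : ∀ a b → + (a ℕ.* k ℕ.+ b) ≡ + a ℤ.* + k ℤ.+ + b
    cast a b = ≡.trans (ℤₚ.pos-+ (a ℕ.* k) b) (≡.cong (ℤ._+ + b) (ℤₚ.pos-* a k))
    index : ∀ s r → (s ℕ.* k ℕ.+ r) ⊖ K ≡ (s ⊖ J) ℤ.* + k ℤ.+ (r ⊖ m)
    index s r rewrite ≡.sym (ℤₚ.m-n≡m⊖n (s ℕ.* k ℕ.+ r) K) | ≡.sym (ℤₚ.m-n≡m⊖n s J) | ≡.sym (ℤₚ.m-n≡m⊖n r m)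
      | cast s r | cast J m =
      solveℤ 5 (λ s k r J m → (s *ᶻ k +ᶻ r) -ᶻ (J *ᶻ k +ᶻ m) =ᶻ (s -ᶻ J) *ᶻ k +ᶻ (r -ᶻ m)) ≡.refl (+ s) (+ k) (+ r) (+ J) (+ m)

  -- Sums over the pairs (a , b) with a + b = n.
  Σ-diag : ℕ → (ℕ → ℕ → Carrier) → Carrier
  Σ-diag zero    g = g 0 0
  Σ-diag (suc n) g = Σ-diag n (λ a b → g a (suc b)) + g (suc n) 0

  Σ-diag-head : ∀ n g → Σ-diag (suc n) g ≈ g 0 (suc n) + Σ-diag n (λ a b → g (suc a) b)
  Σ-diag-head zero    g = refl
  Σ-diag-head (suc n) g = trans (+-congʳ (Σ-diag-head n (λ a b → g a (suc b)))) (+-assoc _ _ _)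

  Σ-diag-cong : ∀ n {f g : ℕ → ℕ → Carrier} → (∀ a b → a ℕ.+ b ≡ n → f a b ≈ g a b) → Σ-diag n f ≈ Σ-diag n g
  Σ-diag-cong zero    h = h 0 0 ≡.refl
  Σ-diag-cong (suc n) h = +-cong
    (Σ-diag-cong n (λ a b a+b≡n → h a (suc b) (≡.trans (ℕₚ.+-suc a b) (≡.cong suc a+b≡n))))
    (h (suc n) 0 (ℕₚ.+-identityʳ (suc n)))

  Σ-diag-+ : ∀ n f g → Σ-diag n (λ a b → f a b + g a b) ≈ Σ-diag n f + Σ-diag n g
  Σ-diag-+ zero    f g = refl
  Σ-diag-+ (suc n) f g = trans (+-congʳ (Σ-diag-+ n _ _))
    (solve 4 (λ a b u v → (a :+ b) :+ (u :+ v) := (a :+ u) :+ (b :+ v)) refl _ _ _ _)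

  Σ-diag-distribˡ : ∀ n u f → u * Σ-diag n f ≈ Σ-diag n (λ a b → u * f a b)
  Σ-diag-distribˡ zero    u f = refl
  Σ-diag-distribˡ (suc n) u f = trans (distribˡ u _ _) (+-congʳ (Σ-diag-distribˡ n u _))

  Σ-diag-const : ∀ n (f : ℕ → Carrier) → Σ-diag n (λ a _ → f a) ≈ Σ< (suc n) f
  Σ-diag-const zero    f = sym (+-identityˡ _)
  Σ-diag-const (suc n) f = +-congʳ (Σ-diag-const n f)

-- Triangular numbers and the general term of the theta series

tri : ℕ → ℕ
tri zero    = 0
tri (suc n) = suc n ℕ.+ tri n

-- T j = j (j + 1) / 2 on all of ℤ.
T : ℤ → ℕ
T (+ n)    = tri n
T -[1+ n ] = tri n

n≤tri : ∀ n → n ≤ tri n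
n≤tri zero    = z≤n
n≤tri (suc n) = ℕₚ.m≤m+n (suc n) (tri n)

-- T(-n) = T(n - 1). Splitting off n leaves x and y with the common exponent T(-n), hence a power of
-- Q = xy.
tri≡n+T-n : ∀ n → tri n ≡ n ℕ.+ T (ℤ.- (+ n))
tri≡n+T-n zero    = ≡.refl
tri≡n+T-n (suc n) = ≡.refl

m⊖[m+n]≡-n : ∀ m n → m ⊖ (m ℕ.+ n) ≡ ℤ.- (+ n)
m⊖[m+n]≡-n zero    zero    = ≡.refl
m⊖[m+n]≡-n zero    (suc n) = ≡.refl
m⊖[m+n]≡-n (suc m) n = ≡.trans (ℤₚ.[1+m]⊖[1+n]≡m⊖n m (m ℕ.+ n)) (m⊖[m+n]≡-n m n)

[m+n]⊖m≡n : ∀ m n → (m ℕ.+ n) ⊖ m ≡ + n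
[m+n]⊖m≡n zero    n = ≡.refl
[m+n]⊖m≡n (suc m) n = ≡.trans (ℤₚ.[1+m]⊖[1+n]≡m⊖n (m ℕ.+ n) m) ([m+n]⊖m≡n m n)

-- The comparison comes with an explicit difference, so that `m ⊖ n` can be rewritten as a signed
-- natural number.
≤-or-> : ∀ m n → (∃ λ d → n ≡ m ℕ.+ d) ⊎ (∃ λ d → m ≡ suc n ℕ.+ d)
≤-or-> m n with ℕₚ.≤-<-connex m n
... | inj₁ m≤n = inj₁ (n ℕ.∸ m , ≡.sym (ℕₚ.m+[n∸m]≡n m≤n))
... | inj₂ n<m = inj₂ (m ℕ.∸ suc n , ≡.sym (ℕₚ.m+[n∸m]≡n n<m))

module Theta {c ℓ} (R : CommutativeRing c ℓ) where
  open CommutativeRing R hiding (zero)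
  open IntegerCoefficients R
  open Solver using (solve; _:=_; con; _:*_; :-_)
  open Exp semiring
  open CommExp commutativeSemiring using (^-distrib-*)
  open import Relation.Binary.Reasoning.Setoid setoid

  -- General term of Ramanujan's theta function f(-x, -y). Both exponents are natural for every
  -- integer j, so x and y may be nilpotent.
  θ-term : Carrier → Carrier → ℤ → Carrier
  θ-term x y j = (- 1#) ^ ℤ.∣ j ∣ * (x ^ T j * y ^ T (ℤ.- j))

  θ-term-neg : ∀ x y j → θ-term x y (ℤ.- j) ≈ θ-term y x j
  θ-term-neg x y j rewrite ℤₚ.∣-i∣≡∣i∣ j | ℤₚ.neg-involutive j = *-congˡ (*-comm _ _)

  ^-zero-≥ : ∀ z {m n} → m ≤ n → z ^ m ≈ 0# → z ^ n ≈ 0#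
  ^-zero-≥ z {m} {n} m≤n z^m≈0 = begin
    z ^ n                    ≡⟨ ≡.cong (z ^_) (ℕₚ.m+[n∸m]≡n m≤n) ⟨
    z ^ (m ℕ.+ (n ℕ.∸ m))    ≈⟨ ^-homo-* z m (n ℕ.∸ m) ⟩
    z ^ m * z ^ (n ℕ.∸ m)    ≈⟨ *-congʳ z^m≈0 ⟩
    0# * z ^ (n ℕ.∸ m)       ≈⟨ zeroˡ _ ⟩
    0#                       ∎

  -- From index -j to -j - 1 the exponent of x grows by j and that of y by j + 1, which amounts to a
  -- factor -y (xy)^j.
  θ-term-step⁻ : ∀ x y u j →
    (x * y) ^ u * θ-term x y -[1+ j ] ≈ - (y * (x * y) ^ (u ℕ.+ j) * θ-term x y (ℤ.- (+ j)))
  θ-term-step⁻ x y u j rewrite ℤₚ.∣-i∣≡∣i∣ (+ j) | ℤₚ.neg-involutive (+ j) = begin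
    Q ^ u * (- 1# * s * (x ^ tri j * y ^ (suc j ℕ.+ tri j)))
      ≈⟨ *-congˡ (*-congˡ (*-cong x-power (^-homo-* y (suc j) (tri j)))) ⟩
    Q ^ u * (- 1# * s * ((x ^ j * X) * (y * y ^ j * y ^ tri j)))
      ≈⟨ solve 7 (λ Qu s xj X y yj Y →
           Qu :* (:- con (+ 1) :* s :* ((xj :* X) :* (y :* yj :* Y)))
           := :- (y :* (Qu :* (xj :* yj)) :* (s :* (X :* Y)))) refl _ _ _ _ _ _ _ ⟩
    - (y * (Q ^ u * (x ^ j * y ^ j)) * (s * (X * y ^ tri j)))
      ≈⟨ -‿cong (*-congʳ (*-congˡ (sym (trans (^-homo-* Q u j) (*-congˡ (^-distrib-* x y j)))))) ⟩
    - (y * Q ^ (u ℕ.+ j) * (s * (X * y ^ tri j))) ∎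
    where
    Q = x * y
    s = (- 1#) ^ j
    X = x ^ T (ℤ.- (+ j))
    x-power : x ^ tri j ≈ x ^ j * X
    x-power = trans (^-congʳ x (tri≡n+T-n j)) (^-homo-* x j _)

  -- From index j to j + 1 the exponent of x grows by j + 1 and that of y by j; a further factor y
  -- completes (xy)^(j + 1).
  θ-term-step⁺ : ∀ x y v j →
    (x * y) ^ (v ℕ.+ suc j) * θ-term x y (+ j) ≈ - (y * (x * y) ^ v * θ-term x y (+ suc j))
  θ-term-step⁺ x y v j = begin
    Q ^ (v ℕ.+ suc j) * (s * (x ^ tri j * Y))
      ≈⟨ *-congʳ (trans (^-homo-* Q v (suc j)) (*-congˡ (^-distrib-* x y (suc j)))) ⟩
    (Q ^ v * ((x * x ^ j) * (y * y ^ j))) * (s * (x ^ tri j * Y))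
      ≈⟨ solve 8 (λ Qv s x xj X y yj Y →
           (Qv :* ((x :* xj) :* (y :* yj))) :* (s :* (X :* Y))
           := :- (y :* Qv :* (:- con (+ 1) :* s :* ((x :* xj :* X) :* (yj :* Y))))) refl _ _ _ _ _ _ _ _ ⟩
    - (y * Q ^ v * (- 1# * s * ((x * x ^ j * x ^ tri j) * (y ^ j * Y))))
      ≈⟨ -‿cong (*-congˡ (*-congˡ (*-cong (sym (^-homo-* x (suc j) (tri j))) (sym y-power)))) ⟩
    - (y * Q ^ v * (- 1# * s * (x ^ (suc j ℕ.+ tri j) * y ^ tri j))) ∎
    where
    Q = x * y
    s = (- 1#) ^ j
    Y = y ^ T (ℤ.- (+ j))
    y-power : y ^ tri j ≈ y ^ j * Y
    y-power = trans (^-congʳ y (tri≡n+T-n j)) (^-homo-* y j _)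

  -- This is Q^j θ(j - 1) = -y θ(j) at j = a - k, where Q = xy. Since j may be negative and Q need
  -- not be invertible, j is spread over the two sides as u - v.
  θ-term-step : ∀ x y {u v} a k → u ℕ.+ k ≡ a ℕ.+ v →
    (x * y) ^ u * θ-term x y (a ⊖ suc k) ≈ - (y * (x * y) ^ v * θ-term x y (a ⊖ k))
  θ-term-step x y {u} {v} a k u+k≡a+v with ≤-or-> a k
  ... | inj₁ (j , ≡.refl) = trans
    (*-congˡ (reflexive (≡.cong (θ-term x y) (≡.trans (≡.cong (a ⊖_) (≡.sym (ℕₚ.+-suc a j))) (m⊖[m+n]≡-n a (suc j))))))
    (trans (θ-term-step⁻ x y u j)
    (-‿cong (*-cong (*-congˡ (^-congʳ (x * y) (≡.sym v≡u+j))) (reflexive (≡.cong (θ-term x y) (≡.sym (m⊖[m+n]≡-n a j)))))))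
    where
    v≡u+j : v ≡ u ℕ.+ j
    v≡u+j = ℕₚ.+-cancelˡ-≡ a v (u ℕ.+ j) (≡.trans (≡.sym u+k≡a+v)
      (≡.trans (≡.sym (ℕₚ.+-assoc u a j)) (≡.trans (≡.cong (ℕ._+ j) (ℕₚ.+-comm u a)) (ℕₚ.+-assoc a u j))))
  ... | inj₂ (j , ≡.refl) = trans
    (*-cong (^-congʳ (x * y) u≡v+1+j) (reflexive (≡.cong (θ-term x y) ([m+n]⊖m≡n (suc k) j))))
    (trans (θ-term-step⁺ x y v j)
    (-‿cong (*-congˡ (reflexive (≡.cong (θ-term x y)
      (≡.sym (≡.trans (≡.cong (_⊖ k) (≡.sym (ℕₚ.+-suc k j))) ([m+n]⊖m≡n k (suc j)))))))))
    where
    u≡v+1+j : u ≡ v ℕ.+ suc j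
    u≡v+1+j = ℕₚ.+-cancelʳ-≡ k u (v ℕ.+ suc j) (≡.trans u+k≡a+v (≡.trans (ℕₚ.+-comm (suc k ℕ.+ j) v)
      (≡.trans (≡.cong (λ t → v ℕ.+ suc t) (ℕₚ.+-comm k j)) (≡.sym (ℕₚ.+-assoc v (suc j) k)))))

-- q-Pochhammer symbols and their inverses for nilpotent Q

module Pochhammer {c ℓ} (R : CommutativeRing c ℓ) (Q : CommutativeRing.Carrier R) where
  open CommutativeRing R hiding (zero)
  open IntegerCoefficients R
  open Solver using (solve; _:=_; con; _:+_; _:*_; _:-_)
  open Exp semiring
  open Sums R
  open Theta R using (^-zero-≥)
  open RingProperties ring using (-0#≈0#)
  open import Relation.Binary.Reasoning.Setoid setoid

  -- The symbol (Q; Q)_n.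
  poch : ℕ → Carrier
  poch n = Π< n (λ i → 1# - Q ^ suc i)

  telescope : ∀ z n → (1# - z) * Σ< n (z ^_) ≈ 1# - z ^ n
  telescope z zero    = trans (zeroʳ _) (sym (-‿inverseʳ 1#))
  telescope z (suc n) = begin
    (1# - z) * (Σ< n (z ^_) + z ^ n)           ≈⟨ distribˡ _ _ _ ⟩
    (1# - z) * Σ< n (z ^_) + (1# - z) * z ^ n  ≈⟨ +-congʳ (telescope z n) ⟩
    1# - z ^ n + (1# - z) * z ^ n
      ≈⟨ solve 2 (λ z w → con (+ 1) :- w :+ (con (+ 1) :- z) :* w := con (+ 1) :- z :* w) refl z (z ^ n) ⟩
    1# - z * z ^ n ∎

  -- A factor 1 - Q^e with Q^e w = 0 fixes w; this drops the factors with b < e ≤ b + j one at a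
  -- time from the top.
  absorb : ∀ w b j → (∀ i → b ℕ.+ suc i ≤ b ℕ.+ j → Q ^ (b ℕ.+ suc i) * w ≈ 0#) → poch (b ℕ.+ j) * w ≈ poch b * w
  absorb w b zero    h rewrite ℕₚ.+-identityʳ b = refl
  absorb w b (suc j) h = begin
    poch (b ℕ.+ suc j) * w                     ≡⟨ ≡.cong (λ t → poch t * w) (ℕₚ.+-suc b j) ⟩
    poch (b ℕ.+ j) * (1# - Q ^ suc (b ℕ.+ j)) * w
      ≈⟨ solve 3 (λ p z w → p :* (con (+ 1) :- z) :* w := p :* w :- p :* (z :* w)) refl _ _ _ ⟩
    poch (b ℕ.+ j) * w - poch (b ℕ.+ j) * (Q ^ suc (b ℕ.+ j) * w)
      ≈⟨ +-cong (absorb w b j (λ i le → h i (ℕₚ.≤-trans le (ℕₚ.+-monoʳ-≤ b (ℕₚ.n≤1+n j)))))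
           (-‿cong (*-congˡ (trans (*-congʳ (^-congʳ Q (≡.sym (ℕₚ.+-suc b j)))) (h j ℕₚ.≤-refl)))) ⟩
    poch b * w - poch (b ℕ.+ j) * 0#           ≈⟨ +-congˡ (trans (-‿cong (zeroʳ _)) -0#≈0#) ⟩
    poch b * w + 0#                            ≈⟨ +-identityʳ _ ⟩
    poch b * w                                 ∎

  module Nilpotent (N : ℕ) (Q^N≈0 : Q ^ N ≈ 0#) where

    -- The inverse of 1 - Q^(i + 1): N terms of the geometric series suffice because Q^N vanishes.
    geometric : ℕ → Carrier
    geometric i = Σ< N (λ s → (Q ^ suc i) ^ s)

    geometric-inverse : ∀ i → (1# - Q ^ suc i) * geometric i ≈ 1#
    geometric-inverse i = begin
      (1# - Q ^ suc i) * geometric i   ≈⟨ telescope (Q ^ suc i) N ⟩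
      1# - (Q ^ suc i) ^ N             ≈⟨ +-congˡ (-‿cong (trans (^-assocʳ Q (suc i) N) (^-zero-≥ Q (ℕₚ.m≤m+n N _) Q^N≈0))) ⟩
      1# - 0#                          ≈⟨ trans (+-congˡ -0#≈0#) (+-identityʳ 1#) ⟩
      1#                               ∎

    poch⁻¹ : ℕ → Carrier
    poch⁻¹ n = Π< n geometric

    poch-inverse : ∀ n → poch n * poch⁻¹ n ≈ 1#
    poch-inverse n = trans (sym (Π<-* n _ _)) (trans (Π<-cong n (λ i _ → geometric-inverse i)) (Π<-1 n))

    -- Raises the denominator, so that the binomials in Pascal's rule can be compared over a common
    -- one.
    poch⁻¹-pred : ∀ n → poch⁻¹ n ≈ (1# - Q ^ suc n) * poch⁻¹ (suc n)
    poch⁻¹-pred n = begin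
      poch⁻¹ n                                       ≈⟨ *-identityˡ _ ⟨
      1# * poch⁻¹ n                                  ≈⟨ *-congʳ (geometric-inverse n) ⟨
      (1# - Q ^ suc n) * geometric n * poch⁻¹ n      ≈⟨ trans (*-assoc _ _ _) (*-congˡ (*-comm _ _)) ⟩
      (1# - Q ^ suc n) * (poch⁻¹ n * geometric n)    ∎

    poch-stable : ∀ d → poch (N ℕ.+ d) ≈ poch N
    poch-stable d = trans (sym (*-identityʳ _)) (trans
      (absorb 1# N d (λ i _ → trans (*-identityʳ _) (^-zero-≥ Q (ℕₚ.m≤m+n N (suc i)) Q^N≈0)))
      (*-identityʳ _))

-- Cauchy's finite triple product and its exact limit

module TripleProduct {c ℓ} (R : CommutativeRing c ℓ)
  (x y : CommutativeRing.Carrier R) (Q : CommutativeRing.Carrier R)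
  (Q≈xy : CommutativeRing._≈_ R Q (CommutativeRing._*_ R x y)) where
  open CommutativeRing R hiding (zero)
  open IntegerCoefficients R
  open Solver using (solve; _:=_; con; _:+_; _:*_; _:-_; :-_)
  open Exp semiring
  open CommExp commutativeSemiring using (^-distrib-*)
  open Sums R
  open Theta R
  open Pochhammer R Q
  open import Relation.Binary.Reasoning.Setoid setoid

  θ-y-step : ∀ {u v} a k → u ℕ.+ k ≡ a ℕ.+ v →
    Q ^ u * θ-term x y (a ⊖ suc k) ≈ - (y * Q ^ v * θ-term x y (a ⊖ k))
  θ-y-step {u} {v} a k eq = begin
    Q ^ u * θ-term x y (a ⊖ suc k)            ≈⟨ *-congʳ (^-congˡ u Q≈xy) ⟩
    (x * y) ^ u * θ-term x y (a ⊖ suc k)      ≈⟨ θ-term-step x y {u} {v} a k eq ⟩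
    - (y * (x * y) ^ v * θ-term x y (a ⊖ k))  ≈⟨ -‿cong (*-congʳ (*-congˡ (^-congˡ v Q≈xy))) ⟨
    - (y * Q ^ v * θ-term x y (a ⊖ k))        ∎

  θ-x-step : ∀ {u v} a k → u ℕ.+ a ≡ k ℕ.+ v →
    Q ^ u * θ-term x y (suc a ⊖ k) ≈ - (x * Q ^ v * θ-term x y (a ⊖ k))
  θ-x-step {u} {v} a k eq = begin
    Q ^ u * θ-term x y (suc a ⊖ k)            ≈⟨ *-cong (^-congˡ u Q≈yx) (flip (suc a)) ⟩
    (y * x) ^ u * θ-term y x (k ⊖ suc a)      ≈⟨ θ-term-step y x {u} {v} k a eq ⟩
    - (x * (y * x) ^ v * θ-term y x (k ⊖ a))  ≈⟨ -‿cong (*-cong (*-congˡ (^-congˡ v Q≈yx)) (flip a)) ⟨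
    - (x * Q ^ v * θ-term x y (a ⊖ k))        ∎
    where
    Q≈yx = trans Q≈xy (*-comm x y)
    flip : ∀ a → θ-term x y (a ⊖ k) ≈ θ-term y x (k ⊖ a)
    flip a = trans (reflexive (≡.cong (θ-term x y) (ℤₚ.⊖-swap a k))) (θ-term-neg x y (k ⊖ a))

  module _ (N : ℕ) (Q^N≈0 : Q ^ N ≈ 0#) where
    open Nilpotent N Q^N≈0

    -- The Gaussian binomial coefficient [a + b choose a] in base Q.
    gauss : ℕ → ℕ → Carrier
    gauss a b = poch (a ℕ.+ b) * (poch⁻¹ a * poch⁻¹ b)

    gauss-0ˡ : ∀ b → gauss 0 b ≈ 1#
    gauss-0ˡ b = trans (*-congˡ (*-identityˡ _)) (poch-inverse b)

    gauss-0ʳ : ∀ a → gauss a 0 ≈ 1#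
    gauss-0ʳ a rewrite ℕₚ.+-identityʳ a = trans (*-congˡ (*-identityʳ _)) (poch-inverse a)

    -- With α = Q^(a + 1) and β = Q^(b + 1), the three binomials of Pascal's rule are 1 - β, 1 - α
    -- and 1 - αβ times one common quantity; the next two lemmas give the other two factors.
    gauss-pred-b : ∀ a b → gauss (suc a) b ≈
      (1# - Q ^ suc b) * (poch (suc (a ℕ.+ b)) * (poch⁻¹ (suc a) * poch⁻¹ (suc b)))
    gauss-pred-b a b = trans (*-congˡ (*-congˡ (poch⁻¹-pred b)))
      (solve 4 (λ p q z r → p :* (q :* (z :* r)) := z :* (p :* (q :* r))) refl _ _ _ _)

    gauss-pred-a : ∀ a b → gauss a (suc b) ≈
      (1# - Q ^ suc a) * (poch (suc (a ℕ.+ b)) * (poch⁻¹ (suc a) * poch⁻¹ (suc b)))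
    gauss-pred-a a b rewrite ℕₚ.+-suc a b = trans (*-congˡ (*-congʳ (poch⁻¹-pred a)))
      (solve 4 (λ p q z r → p :* ((z :* q) :* r) := z :* (p :* (q :* r))) refl _ _ _ _)

    gauss-suc : ∀ a b → gauss (suc a) (suc b) ≈
      (1# - Q ^ suc a * Q ^ suc b) * (poch (suc (a ℕ.+ b)) * (poch⁻¹ (suc a) * poch⁻¹ (suc b)))
    gauss-suc a b = begin
      poch (suc (a ℕ.+ suc b)) * D
        ≡⟨⟩
      poch (a ℕ.+ suc b) * (1# - Q ^ (suc a ℕ.+ suc b)) * D
        ≈⟨ *-congʳ (*-cong (reflexive (≡.cong poch (ℕₚ.+-suc a b))) (+-congˡ (-‿cong (^-homo-* Q (suc a) (suc b))))) ⟩
      poch (suc (a ℕ.+ b)) * (1# - Q ^ suc a * Q ^ suc b) * D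
        ≈⟨ trans (*-congʳ (*-comm _ _)) (*-assoc _ _ _) ⟩
      (1# - Q ^ suc a * Q ^ suc b) * (poch (suc (a ℕ.+ b)) * D) ∎
      where D = poch⁻¹ (suc a) * poch⁻¹ (suc b)

    -- Rests on 1 - αβ = (1 - β) + β(1 - α). The second rule rests on 1 - αβ = α(1 - β) + (1 - α).
    -- The first will produce the factors in x, the second those in y.
    pascal₁ : ∀ a b → gauss (suc a) (suc b) ≈ 1# * gauss (suc a) b + Q ^ suc b * gauss a (suc b)
    pascal₁ a b = trans (gauss-suc a b) (trans
      (solve 3 (λ α β D → (con (+ 1) :- α :* β) :* D
        := con (+ 1) :* ((con (+ 1) :- β) :* D) :+ β :* ((con (+ 1) :- α) :* D)) refl _ _ _)
      (sym (+-cong (*-congˡ (gauss-pred-b a b)) (*-congˡ (gauss-pred-a a b)))))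

    pascal₂ : ∀ a b → gauss (suc a) (suc b) ≈ Q ^ suc a * gauss (suc a) b + 1# * gauss a (suc b)
    pascal₂ a b = trans (gauss-suc a b) (trans
      (solve 3 (λ α β D → (con (+ 1) :- α :* β) :* D
        := α :* ((con (+ 1) :- β) :* D) :+ con (+ 1) :* ((con (+ 1) :- α) :* D)) refl _ _ _)
      (sym (+-cong (*-congˡ (gauss-pred-b a b)) (*-congˡ (gauss-pred-a a b)))))

    -- Both rules regroup a diagonal sum in the same way, so their weights are parameters. The edge
    -- conditions extend the rule to the sides of the triangle, where one predecessor is missing.
    module PascalSum (α β : ℕ → ℕ → Carrier)
      (α-edge : ∀ b → α 0 b ≈ 1#) (β-edge : ∀ a → β a 0 ≈ 1#)
      (pascal : ∀ a b → gauss (suc a) (suc b) ≈ α (suc a) b * gauss (suc a) b + β a (suc b) * gauss a (suc b)) where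

      fromLeft fromBelow : ℕ → ℕ → Carrier
      fromLeft a zero    = 0#
      fromLeft a (suc b) = α a b * gauss a b
      fromBelow zero    b = 0#
      fromBelow (suc a) b = β a b * gauss a b

      -- Each binomial at (a, b) on diagonal n feeds exactly (a, b + 1) and (a + 1, b); the sum is
      -- collected by this predecessor.
      Σ-pascal : ∀ n (w : ℕ → Carrier) → Σ-diag (suc n) (λ a b → w a * gauss a b) ≈
        Σ-diag n (λ a b → (α a b * w a + β a b * w (suc a)) * gauss a b)
      Σ-pascal n w = begin
        Σ-diag (suc n) (λ a b → w a * gauss a b)
          ≈⟨ Σ-diag-cong (suc n) split ⟩
        Σ-diag (suc n) (λ a b → w a * fromLeft a b + w a * fromBelow a b)
          ≈⟨ Σ-diag-+ (suc n) (λ a b → w a * fromLeft a b) (λ a b → w a * fromBelow a b) ⟩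
        Σ-diag (suc n) (λ a b → w a * fromLeft a b) + Σ-diag (suc n) (λ a b → w a * fromBelow a b)
          -- The two sums lose opposite ends of the diagonal, (n + 1, 0) and (0, n + 1), where the
          -- predecessor is missing.
          ≈⟨ +-cong (trans (+-congˡ (zeroʳ _)) (+-identityʳ _))
                    (trans (Σ-diag-head n (λ a b → w a * fromBelow a b)) (trans (+-congʳ (zeroʳ _)) (+-identityˡ _))) ⟩
        Σ-diag n (λ a b → w a * (α a b * gauss a b)) + Σ-diag n (λ a b → w (suc a) * (β a b * gauss a b))
          ≈⟨ Σ-diag-+ n _ _ ⟨
        Σ-diag n (λ a b → w a * (α a b * gauss a b) + w (suc a) * (β a b * gauss a b))
          ≈⟨ Σ-diag-cong n (λ a b _ → solve 5 (λ w α g w′ β →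
               w :* (α :* g) :+ w′ :* (β :* g) := (α :* w :+ β :* w′) :* g) refl _ _ _ _ _) ⟩
        Σ-diag n (λ a b → (α a b * w a + β a b * w (suc a)) * gauss a b) ∎
        where
        split : ∀ a b → a ℕ.+ b ≡ suc n → w a * gauss a b ≈ w a * fromLeft a b + w a * fromBelow a b
        split zero    (suc b) _ = begin
          w 0 * gauss 0 (suc b)   ≈⟨ *-congˡ (trans (gauss-0ˡ (suc b)) (sym (trans (*-cong (α-edge b) (gauss-0ˡ b)) (*-identityˡ 1#)))) ⟩
          w 0 * (α 0 b * gauss 0 b) ≈⟨ trans (+-congˡ (zeroʳ _)) (+-identityʳ _) ⟨
          w 0 * (α 0 b * gauss 0 b) + w 0 * 0# ∎
        split (suc a) zero    _ = begin
          w (suc a) * gauss (suc a) 0 ≈⟨ *-congˡ (trans (gauss-0ʳ (suc a)) (sym (trans (*-cong (β-edge a) (gauss-0ʳ a)) (*-identityˡ 1#)))) ⟩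
          w (suc a) * (β a 0 * gauss a 0) ≈⟨ trans (+-congʳ (zeroʳ _)) (+-identityˡ _) ⟨
          w (suc a) * 0# + w (suc a) * (β a 0 * gauss a 0) ∎
        split (suc a) (suc b) _ = trans (*-congˡ (pascal a b)) (distribˡ _ _ _)

    module Pascal₁ = PascalSum (λ _ _ → 1#) (λ _ b → Q ^ b) (λ _ → refl) (λ _ → refl) pascal₁
    module Pascal₂ = PascalSum (λ a _ → Q ^ a) (λ _ _ → 1#) (λ _ → refl) (λ _ → refl) pascal₂

    -- The sum belonging to k factors in y and n factors in x: the index j = a - k runs from -k to
    -- n.
    finiteSum : ℕ → ℕ → Carrier
    finiteSum k n = Σ-diag (k ℕ.+ n) (λ a b → θ-term x y (a ⊖ k) * gauss a b)

    -- Since a + b = k + n, the step relation gives Q^b θ(a + 1 - k) = -x Q^n θ(a - k). The factor 1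
    -- - x Q^n is the same for all a and comes out of the sum.
    finiteSum-x : ∀ k n → finiteSum k (suc n) ≈ (1# - x * Q ^ n) * finiteSum k n
    finiteSum-x k n rewrite ℕₚ.+-suc k n = begin
      Σ-diag (suc (k ℕ.+ n)) (λ a b → t a * gauss a b)
        ≈⟨ Pascal₁.Σ-pascal (k ℕ.+ n) t ⟩
      Σ-diag (k ℕ.+ n) (λ a b → (1# * t a + Q ^ b * t (suc a)) * gauss a b)
        ≈⟨ Σ-diag-cong (k ℕ.+ n) (λ a b a+b≡k+n → trans
             (*-congʳ (+-congˡ (θ-x-step a k (≡.trans (ℕₚ.+-comm b a) a+b≡k+n))))
             (solve 3 (λ t z g → (con (+ 1) :* t :+ :- (z :* t)) :* g := (con (+ 1) :- z) :* (t :* g)) refl _ _ _)) ⟩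
      Σ-diag (k ℕ.+ n) (λ a b → (1# - x * Q ^ n) * (t a * gauss a b))
        ≈⟨ Σ-diag-distribˡ (k ℕ.+ n) _ _ ⟨
      (1# - x * Q ^ n) * finiteSum k n ∎
      where
      t : ℕ → Carrier
      t a = θ-term x y (a ⊖ k)

    -- Raising k moves the centre, and Q^a θ(a - k - 1) = -y Q^k θ(a - k) makes the common factor 1
    -- - y Q^k.
    finiteSum-y : ∀ k n → finiteSum (suc k) n ≈ (1# - y * Q ^ k) * finiteSum k n
    finiteSum-y k n = begin
      Σ-diag (suc (k ℕ.+ n)) (λ a b → t a * gauss a b)
        ≈⟨ Pascal₂.Σ-pascal (k ℕ.+ n) t ⟩
      Σ-diag (k ℕ.+ n) (λ a b → (Q ^ a * t a + 1# * t (suc a)) * gauss a b)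
        ≈⟨ Σ-diag-cong (k ℕ.+ n) (λ a b _ → trans
             (*-congʳ (+-cong (θ-y-step a k ≡.refl)
                (*-congˡ (reflexive (≡.cong (θ-term x y) (ℤₚ.[1+m]⊖[1+n]≡m⊖n a k))))))
             (solve 3 (λ t z g → (:- (z :* t) :+ con (+ 1) :* t) :* g := (con (+ 1) :- z) :* (t :* g)) refl _ _ _)) ⟩
      Σ-diag (k ℕ.+ n) (λ a b → (1# - y * Q ^ k) * (θ-term x y (a ⊖ k) * gauss a b))
        ≈⟨ Σ-diag-distribˡ (k ℕ.+ n) _ _ ⟨
      (1# - y * Q ^ k) * finiteSum k n ∎
      where
      t : ℕ → Carrier
      t a = θ-term x y (a ⊖ suc k)

    finiteProduct : ∀ k n → finiteSum k n ≈ Π< k (λ i → 1# - y * Q ^ i) * Π< n (λ i → 1# - x * Q ^ i)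
    finiteProduct zero zero = trans (*-congʳ (trans (*-identityˡ _) (*-identityˡ _))) (*-congˡ (gauss-0ˡ 0))
    finiteProduct zero (suc n) = trans (finiteSum-x 0 n) (trans (*-congˡ (finiteProduct zero n))
      (solve 2 (λ z p → z :* (con (+ 1) :* p) := con (+ 1) :* (p :* z)) refl _ _))
    finiteProduct (suc k) n = trans (finiteSum-y k n) (trans (*-congˡ (finiteProduct k n))
      (solve 3 (λ z p r → z :* (p :* r) := (p :* z) :* r) refl _ _ _))

    -- w is a multiple of Q^(tri (j - 1)), so that all factors 1 - Q^i with N - j < i ≤ N fix it.
    limit-weight : ∀ b j w v → b ℕ.+ j ≡ N → w ≈ Q ^ T (ℤ.- (+ j)) * v →
      poch N * gauss (N ℕ.+ j) b * w ≈ w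
    limit-weight b j w v ≡.refl w≈ = begin
      poch N * (poch (N ℕ.+ j ℕ.+ b) * (poch⁻¹ (N ℕ.+ j) * poch⁻¹ b)) * w
        ≈⟨ *-congʳ (*-congˡ (*-congʳ (trans (trans (reflexive (≡.cong poch (ℕₚ.+-assoc N j b))) (poch-stable (j ℕ.+ b))) (sym (poch-stable j))))) ⟩
      poch N * (poch (N ℕ.+ j) * (poch⁻¹ (N ℕ.+ j) * poch⁻¹ b)) * w
        ≈⟨ solve 5 (λ p a a′ b′ w → p :* (a :* (a′ :* b′)) :* w := (a :* a′) :* b′ :* (p :* w)) refl _ _ _ _ _ ⟩
      (poch (N ℕ.+ j) * poch⁻¹ (N ℕ.+ j)) * poch⁻¹ b * (poch N * w)
        ≈⟨ *-cong (*-congʳ (poch-inverse (N ℕ.+ j))) (absorb w b j kill) ⟩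
      1# * poch⁻¹ b * (poch b * w)
        ≈⟨ solve 3 (λ p q w → con (+ 1) :* p :* (q :* w) := (q :* p) :* w) refl _ _ _ ⟩
      (poch b * poch⁻¹ b) * w
        ≈⟨ trans (*-congʳ (poch-inverse b)) (*-identityˡ w) ⟩
      w ∎
      where
      -- T(-j) ≥ j - 1, so the exponent reaches b + j = N already for i = 0.
      bound : ∀ j i → i < j → j ≤ suc i ℕ.+ T (ℤ.- (+ j))
      bound (suc j) i _ = s≤s (ℕₚ.≤-trans (n≤tri j) (ℕₚ.m≤n+m (tri j) i))
      kill : ∀ i → b ℕ.+ suc i ≤ b ℕ.+ j → Q ^ (b ℕ.+ suc i) * w ≈ 0#
      kill i le = begin
        Q ^ (b ℕ.+ suc i) * w                               ≈⟨ *-congˡ w≈ ⟩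
        Q ^ (b ℕ.+ suc i) * (Q ^ T (ℤ.- (+ j)) * v)         ≈⟨ *-assoc _ _ _ ⟨
        Q ^ (b ℕ.+ suc i) * Q ^ T (ℤ.- (+ j)) * v           ≈⟨ *-congʳ (^-homo-* Q (b ℕ.+ suc i) _) ⟨
        Q ^ (b ℕ.+ suc i ℕ.+ T (ℤ.- (+ j))) * v
          ≈⟨ *-congʳ (^-zero-≥ Q (ℕₚ.≤-trans (ℕₚ.+-monoʳ-≤ b (bound j i (ℕₚ.+-cancelˡ-≤ b (suc i) j le)))
               (ℕₚ.≤-reflexive (≡.sym (ℕₚ.+-assoc b (suc i) _)))) Q^N≈0) ⟩
        0# * v                                              ≈⟨ zeroˡ v ⟩
        0#                                                  ∎

    gauss-comm : ∀ a b → gauss a b ≈ gauss b a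
    gauss-comm a b = *-cong (reflexive (≡.cong poch (ℕₚ.+-comm a b))) (*-comm _ _)

    -- If |a - N| = j, then one of a, b is N + j and the other N - j, while the theta term is
    -- divisible by Q^T(-j). Symmetry of the binomial, together with exchanging x and y, reduces
    -- both signs to `limit-weight`.
    limit-θ : ∀ a b → a ℕ.+ b ≡ N ℕ.+ N → poch N * (θ-term x y (a ⊖ N) * gauss a b) ≈ θ-term x y (a ⊖ N)
    limit-θ a b a+b≡2N = trans (solve 3 (λ p t g → p :* (t :* g) := p :* g :* t) refl _ _ _) (cases (≤-or-> a N))
      where
      t = θ-term x y (a ⊖ N)
      factor : ∀ x y j → Q ≈ x * y → θ-term x y (+ j) ≈ Q ^ T (ℤ.- (+ j)) * ((- 1#) ^ j * x ^ j)
      factor x y j Q≈ = begin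
        (- 1#) ^ j * (x ^ tri j * y ^ r)
          ≈⟨ *-congˡ (*-congʳ (trans (^-congʳ x (tri≡n+T-n j)) (^-homo-* x j r))) ⟩
        (- 1#) ^ j * (x ^ j * x ^ r * y ^ r)
          ≈⟨ solve 4 (λ s a b d → s :* (a :* b :* d) := (b :* d) :* (s :* a)) refl _ _ _ _ ⟩
        (x ^ r * y ^ r) * ((- 1#) ^ j * x ^ j)
          ≈⟨ *-congʳ (trans (^-congˡ r Q≈) (^-distrib-* x y r)) ⟨
        Q ^ r * ((- 1#) ^ j * x ^ j) ∎
        where r = T (ℤ.- (+ j))
      cases : _ → poch N * gauss a b * t ≈ t
      cases (inj₁ (j , N≡a+j)) = begin
        poch N * gauss a b * t             ≈⟨ *-congʳ (*-congˡ (gauss-comm a b)) ⟩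
        poch N * gauss b a * t             ≡⟨ ≡.cong (λ z → poch N * gauss z a * t) b≡ ⟩
        poch N * gauss (N ℕ.+ j) a * t
          ≈⟨ limit-weight a j t _ (≡.sym N≡a+j) (trans (reflexive (≡.cong (θ-term x y) t≡))
               (trans (θ-term-neg x y (+ j)) (factor y x j (trans Q≈xy (*-comm x y))))) ⟩
        t                                  ∎
        where
        t≡ : a ⊖ N ≡ ℤ.- (+ j)
        t≡ = ≡.trans (≡.cong (a ⊖_) N≡a+j) (m⊖[m+n]≡-n a j)
        b≡ : b ≡ N ℕ.+ j
        b≡ = ℕₚ.+-cancelˡ-≡ a b (N ℕ.+ j) (≡.trans a+b≡2N (≡.trans (≡.cong (N ℕ.+_) N≡a+j)
          (≡.trans (≡.sym (ℕₚ.+-assoc N a j)) (≡.trans (≡.cong (ℕ._+ j) (ℕₚ.+-comm N a)) (ℕₚ.+-assoc a N j)))))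
      cases (inj₂ (j , a≡)) = begin
        poch N * gauss a b * t                   ≡⟨ ≡.cong (λ z → poch N * gauss z b * t) a≡′ ⟩
        poch N * gauss (N ℕ.+ suc j) b * t
          ≈⟨ limit-weight b (suc j) t _ b+j≡N (trans (reflexive (≡.cong (θ-term x y) t≡)) (factor x y (suc j) Q≈xy)) ⟩
        t                                        ∎
        where
        a≡′ : a ≡ N ℕ.+ suc j
        a≡′ = ≡.trans a≡ (≡.sym (ℕₚ.+-suc N j))
        t≡ : a ⊖ N ≡ + suc j
        t≡ = ≡.trans (≡.cong (_⊖ N) a≡′) ([m+n]⊖m≡n N (suc j))
        b+j≡N : b ℕ.+ suc j ≡ N
        b+j≡N = ℕₚ.+-cancelˡ-≡ N (b ℕ.+ suc j) N (≡.trans (≡.cong (N ℕ.+_) (ℕₚ.+-comm b (suc j)))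
          (≡.trans (≡.sym (ℕₚ.+-assoc N (suc j) b)) (≡.trans (≡.cong (ℕ._+ b) (≡.sym a≡′)) a+b≡2N)))

    tripleProduct :
      Π< N (λ i → 1# - y * Q ^ i) * Π< N (λ i → 1# - x * Q ^ i) * poch N ≈ Σ± N (θ-term x y)
    tripleProduct = begin
      Π< N (λ i → 1# - y * Q ^ i) * Π< N (λ i → 1# - x * Q ^ i) * poch N
        ≈⟨ trans (*-comm _ _) (*-congˡ (sym (finiteProduct N N))) ⟩
      poch N * finiteSum N N
        ≈⟨ Σ-diag-distribˡ (N ℕ.+ N) _ _ ⟩
      Σ-diag (N ℕ.+ N) (λ a b → poch N * (θ-term x y (a ⊖ N) * gauss a b))
        ≈⟨ Σ-diag-cong (N ℕ.+ N) limit-θ ⟩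
      Σ-diag (N ℕ.+ N) (λ a _ → θ-term x y (a ⊖ N))
        ≈⟨ Σ-diag-const (N ℕ.+ N) (λ a → θ-term x y (a ⊖ N)) ⟩
      Σ± N (θ-term x y) ∎

-- Formal power series over ℤ and their truncation

module PowerSeries where
  open ≡.≡-Reasoning
  open ℤSolver.+-*-Solver using (solve; _:=_; _:+_; _:*_)

  Series : Set
  Series = ℕ → ℤ

  infixl 6 _⊕_
  infixl 7 _⊛_

  _⊕_ : Series → Series → Series
  (f ⊕ g) n = f n ℤ.+ g n

  ⊝_ : Series → Series
  (⊝ f) n = ℤ.- f n

  tail : Series → Series
  tail f n = f (suc n)

  -- The Cauchy product in the form f g = f(0) g + q (tail f) g, structurally recursive in the
  -- degree.
  _⊛_ : Series → Series → Series
  (f ⊛ g) zero    = f 0 ℤ.* g 0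
  (f ⊛ g) (suc n) = f 0 ℤ.* g (suc n) ℤ.+ (tail f ⊛ g) n

  𝟘 𝟙 X : Series
  𝟘 _ = 0ℤ
  𝟙 zero    = 1ℤ
  𝟙 (suc _) = 0ℤ
  X zero    = 0ℤ
  X (suc n) = 𝟙 n

  ⊛-cong : ∀ {f f′ g g′} n → (∀ i → i ≤ n → f i ≡ f′ i) → (∀ i → i ≤ n → g i ≡ g′ i) → (f ⊛ g) n ≡ (f′ ⊛ g′) n
  ⊛-cong zero    p q = ≡.cong₂ ℤ._*_ (p 0 z≤n) (q 0 z≤n)
  ⊛-cong (suc n) p q = ≡.cong₂ ℤ._+_ (≡.cong₂ ℤ._*_ (p 0 z≤n) (q (suc n) ℕₚ.≤-refl))
    (⊛-cong n (λ i i≤n → p (suc i) (s≤s i≤n)) (λ i i≤n → q i (ℕₚ.m≤n⇒m≤1+n i≤n)))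

  ⊛-congʳ : ∀ g {f f′} → f ≗ f′ → f ⊛ g ≗ f′ ⊛ g
  ⊛-congʳ g p n = ⊛-cong n (λ i _ → p i) (λ _ _ → ≡.refl)

  ⊛-sucʳ : ∀ f g n → (f ⊛ g) (suc n) ≡ f (suc n) ℤ.* g 0 ℤ.+ (f ⊛ tail g) n
  ⊛-sucʳ f g zero    = ℤₚ.+-comm (f 0 ℤ.* g 1) (f 1 ℤ.* g 0)
  ⊛-sucʳ f g (suc n) = begin
    f 0 ℤ.* g (suc (suc n)) ℤ.+ (tail f ⊛ g) (suc n)
      ≡⟨ ≡.cong (ℤ._+_ (f 0 ℤ.* g (suc (suc n)))) (⊛-sucʳ (tail f) g n) ⟩
    f 0 ℤ.* g (suc (suc n)) ℤ.+ (f (suc (suc n)) ℤ.* g 0 ℤ.+ (tail f ⊛ tail g) n)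
      ≡⟨ solve 3 (λ a b c → a :+ (b :+ c) := b :+ (a :+ c)) ≡.refl (f 0 ℤ.* g (suc (suc n))) (f (suc (suc n)) ℤ.* g 0) ((tail f ⊛ tail g) n) ⟩
    f (suc (suc n)) ℤ.* g 0 ℤ.+ (f 0 ℤ.* g (suc (suc n)) ℤ.+ (tail f ⊛ tail g) n) ∎

  ⊛-comm : ∀ f g → f ⊛ g ≗ g ⊛ f
  ⊛-comm f g zero    = ℤₚ.*-comm (f 0) (g 0)
  ⊛-comm f g (suc n) = begin
    f 0 ℤ.* g (suc n) ℤ.+ (tail f ⊛ g) n   ≡⟨ ≡.cong₂ ℤ._+_ (ℤₚ.*-comm (f 0) (g (suc n))) (⊛-comm (tail f) g n) ⟩
    g (suc n) ℤ.* f 0 ℤ.+ (g ⊛ tail f) n   ≡⟨ ⊛-sucʳ g f n ⟨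
    (g ⊛ f) (suc n)                        ∎

  ⊛-distribʳ : ∀ h f g → (f ⊕ g) ⊛ h ≗ (f ⊛ h) ⊕ (g ⊛ h)
  ⊛-distribʳ h f g zero    = ℤₚ.*-distribʳ-+ (h 0) (f 0) (g 0)
  ⊛-distribʳ h f g (suc n) = begin
    (f 0 ℤ.+ g 0) ℤ.* h (suc n) ℤ.+ ((tail f ⊕ tail g) ⊛ h) n
      ≡⟨ ≡.cong (ℤ._+_ ((f 0 ℤ.+ g 0) ℤ.* h (suc n))) (⊛-distribʳ h (tail f) (tail g) n) ⟩
    (f 0 ℤ.+ g 0) ℤ.* h (suc n) ℤ.+ ((tail f ⊛ h) n ℤ.+ (tail g ⊛ h) n)
      ≡⟨ solve 5 (λ a b c d e → (a :+ b) :* c :+ (d :+ e) := (a :* c :+ d) :+ (b :* c :+ e)) ≡.refl (f 0) (g 0) (h (suc n)) _ _ ⟩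
    ((f ⊛ h) ⊕ (g ⊛ h)) (suc n) ∎

  scale : ℤ → Series → Series
  scale a f n = a ℤ.* f n

  scale-⊛ : ∀ a f g → scale a f ⊛ g ≗ scale a (f ⊛ g)
  scale-⊛ a f g zero    = ℤₚ.*-assoc a (f 0) (g 0)
  scale-⊛ a f g (suc n) = begin
    (a ℤ.* f 0) ℤ.* g (suc n) ℤ.+ (scale a (tail f) ⊛ g) n
      ≡⟨ ≡.cong (ℤ._+_ ((a ℤ.* f 0) ℤ.* g (suc n))) (scale-⊛ a (tail f) g n) ⟩
    (a ℤ.* f 0) ℤ.* g (suc n) ℤ.+ a ℤ.* (tail f ⊛ g) n
      ≡⟨ solve 4 (λ a b c d → (a :* b) :* c :+ a :* d := a :* (b :* c :+ d)) ≡.refl a (f 0) (g (suc n)) _ ⟩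
    a ℤ.* (f ⊛ g) (suc n) ∎

  -- The tail of `f ⊛ g` unfolds to `scale (f 0) (tail g) ⊕ (tail f ⊛ g)`, so distributivity and
  -- scalar multiples carry the induction.
  ⊛-assoc : ∀ f g h → (f ⊛ g) ⊛ h ≗ f ⊛ (g ⊛ h)
  ⊛-assoc f g h zero    = ℤₚ.*-assoc (f 0) (g 0) (h 0)
  ⊛-assoc f g h (suc n) = begin
    f 0 ℤ.* g 0 ℤ.* h (suc n) ℤ.+ ((scale (f 0) (tail g) ⊕ (tail f ⊛ g)) ⊛ h) n
      ≡⟨ ≡.cong (ℤ._+_ (f 0 ℤ.* g 0 ℤ.* h (suc n))) (⊛-distribʳ h (scale (f 0) (tail g)) (tail f ⊛ g) n) ⟩
    f 0 ℤ.* g 0 ℤ.* h (suc n) ℤ.+ ((scale (f 0) (tail g) ⊛ h) n ℤ.+ ((tail f ⊛ g) ⊛ h) n)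
      ≡⟨ ≡.cong (ℤ._+_ (f 0 ℤ.* g 0 ℤ.* h (suc n))) (≡.cong₂ ℤ._+_ (scale-⊛ (f 0) (tail g) h n) (⊛-assoc (tail f) g h n)) ⟩
    f 0 ℤ.* g 0 ℤ.* h (suc n) ℤ.+ (f 0 ℤ.* (tail g ⊛ h) n ℤ.+ (tail f ⊛ (g ⊛ h)) n)
      ≡⟨ solve 5 (λ a b c d e → a :* b :* c :+ (a :* d :+ e) := a :* (b :* c :+ d) :+ e) ≡.refl (f 0) (g 0) (h (suc n)) _ _ ⟩
    f 0 ℤ.* (g ⊛ h) (suc n) ℤ.+ (tail f ⊛ (g ⊛ h)) n ∎

  𝟘-⊛ : ∀ f → 𝟘 ⊛ f ≗ 𝟘
  𝟘-⊛ f zero    = ≡.refl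
  𝟘-⊛ f (suc n) = ≡.trans (ℤₚ.+-identityˡ _) (𝟘-⊛ f n)

  𝟙-⊛ : ∀ f → 𝟙 ⊛ f ≗ f
  𝟙-⊛ f zero    = ℤₚ.*-identityˡ (f 0)
  𝟙-⊛ f (suc n) = ≡.trans (≡.cong₂ ℤ._+_ (ℤₚ.*-identityˡ (f (suc n))) (𝟘-⊛ f n)) (ℤₚ.+-identityʳ _)

  X-⊛-suc : ∀ f n → (X ⊛ f) (suc n) ≡ f n
  X-⊛-suc f n = ≡.trans (ℤₚ.+-identityˡ _) (𝟙-⊛ f n)

-- ℤ[q] / (q ^ L), represented by power series that are compared below L.
module Truncated (L : ℕ) where
  open PowerSeries

  infix 4 _≋_
  -- A record instead of a bare function type lets unification recover f and g from an equation.
  record _≋_ (f g : Series) : Set where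
    constructor below
    field coeff : ∀ n → n < L → f n ≡ g n
  open _≋_ public

  ≗⇒≋ : ∀ {f g} → f ≗ g → f ≋ g
  ≗⇒≋ p = below (λ n _ → p n)

  ring : CommutativeRing 0ℓ 0ℓ
  ring = record
    { Carrier = Series
    ; _≈_ = _≋_
    ; _+_ = _⊕_
    ; _*_ = _⊛_
    ; -_  = ⊝_
    ; 0#  = 𝟘
    ; 1#  = 𝟙
    ; isCommutativeRing = record
      { isRing = record
        { +-isAbelianGroup = record
          { isGroup = record
            { isMonoid = record
              { isSemigroup = record
                { isMagma = record
                  { isEquivalence = record
                    { refl  = ≗⇒≋ (λ _ → ≡.refl)
                    ; sym   = λ p → below (λ n n<L → ≡.sym (coeff p n n<L))
                    ; trans = λ p q → below (λ n n<L → ≡.trans (coeff p n n<L) (coeff q n n<L))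
                    }
                  ; ∙-cong = λ p q → below (λ n n<L → ≡.cong₂ ℤ._+_ (coeff p n n<L) (coeff q n n<L))
                  }
                ; assoc = λ f g h → ≗⇒≋ (λ n → ℤₚ.+-assoc (f n) (g n) (h n))
                }
              ; identity = (λ f → ≗⇒≋ (λ n → ℤₚ.+-identityˡ (f n))) , (λ f → ≗⇒≋ (λ n → ℤₚ.+-identityʳ (f n)))
              }
            ; inverse = (λ f → ≗⇒≋ (λ n → ℤₚ.+-inverseˡ (f n))) , (λ f → ≗⇒≋ (λ n → ℤₚ.+-inverseʳ (f n)))
            ; ⁻¹-cong = λ p → below (λ n n<L → ≡.cong ℤ.-_ (coeff p n n<L))
            }
          ; comm = λ f g → ≗⇒≋ (λ n → ℤₚ.+-comm (f n) (g n))
          }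
        ; *-cong = λ p q → below (λ n n<L → ⊛-cong n
            (λ i i≤n → coeff p i (ℕₚ.≤-<-trans i≤n n<L)) (λ i i≤n → coeff q i (ℕₚ.≤-<-trans i≤n n<L)))
        ; *-assoc = λ f g h → ≗⇒≋ (⊛-assoc f g h)
        ; *-identity = (λ f → ≗⇒≋ (𝟙-⊛ f)) , (λ f → ≗⇒≋ (λ n → ≡.trans (⊛-comm f 𝟙 n) (𝟙-⊛ f n)))
        ; distrib = (λ f g h → ≗⇒≋ (λ n → ≡.trans (⊛-comm f (g ⊕ h) n) (≡.trans (⊛-distribʳ f g h n)
                      (≡.cong₂ ℤ._+_ (⊛-comm g f n) (⊛-comm h f n)))))
                  , (λ f g h → ≗⇒≋ (⊛-distribʳ f g h))
        }
      ; *-comm = λ f g → ≗⇒≋ (⊛-comm f g)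
      }
    }

  open CommutativeRing ring using (semiring)
  open Exp semiring
  open Sums ring

  coeff-X^-≥ : ∀ e f d → (X ^ e ⊛ f) (e ℕ.+ d) ≡ f d
  coeff-X^-≥ zero    f d = 𝟙-⊛ f d
  coeff-X^-≥ (suc e) f d = ≡.trans (⊛-assoc X (X ^ e) f (suc (e ℕ.+ d)))
    (≡.trans (X-⊛-suc (X ^ e ⊛ f) (e ℕ.+ d)) (coeff-X^-≥ e f d))

  coeff-X^-< : ∀ e f n → n < e → (X ^ e ⊛ f) n ≡ 0ℤ
  coeff-X^-< (suc e) f zero    _         = ⊛-assoc X (X ^ e) f 0
  coeff-X^-< (suc e) f (suc n) (s≤s n<e) = ≡.trans (⊛-assoc X (X ^ e) f (suc n))
    (≡.trans (X-⊛-suc (X ^ e ⊛ f) n) (coeff-X^-< e f n n<e))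

  coeff-X^-∸ : ∀ e f {n} → e ≤ n → (X ^ e ⊛ f) n ≡ f (n ℕ.∸ e)
  coeff-X^-∸ e f {n} e≤n = ≡.trans (≡.cong (X ^ e ⊛ f) (≡.sym (ℕₚ.m+[n∸m]≡n e≤n))) (coeff-X^-≥ e f (n ℕ.∸ e))

  X^-vanish : ∀ {e} → L ≤ e → X ^ e ≋ 𝟘
  X^-vanish {e} L≤e = below (λ n n<L → ≡.trans (≡.sym (≡.trans (⊛-comm (X ^ e) 𝟙 n) (𝟙-⊛ (X ^ e) n)))
    (coeff-X^-< e 𝟙 n (ℕₚ.<-≤-trans n<L L≤e)))

  coeff-sign : ∀ i f n → ((⊝ 𝟙) ^ i ⊛ f) n ≡ (ℤ.-1ℤ ℤ.^ i) ℤ.* f n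
  coeff-sign zero    f n = ≡.trans (𝟙-⊛ f n) (≡.sym (ℤₚ.*-identityˡ (f n)))
  coeff-sign (suc i) f n = begin
    (((⊝ 𝟙) ⊛ s) ⊛ f) n               ≡⟨ ⊛-assoc (⊝ 𝟙) s f n ⟩
    ((⊝ 𝟙) ⊛ (s ⊛ f)) n               ≡⟨ ⊛-congʳ (s ⊛ f) ⊝𝟙 n ⟩
    (scale ℤ.-1ℤ 𝟙 ⊛ (s ⊛ f)) n       ≡⟨ scale-⊛ ℤ.-1ℤ 𝟙 (s ⊛ f) n ⟩
    ℤ.-1ℤ ℤ.* (𝟙 ⊛ (s ⊛ f)) n         ≡⟨ ≡.cong (ℤ.-1ℤ ℤ.*_) (≡.trans (𝟙-⊛ (s ⊛ f) n) (coeff-sign i f n)) ⟩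
    ℤ.-1ℤ ℤ.* ((ℤ.-1ℤ ℤ.^ i) ℤ.* f n) ≡⟨ ℤₚ.*-assoc ℤ.-1ℤ (ℤ.-1ℤ ℤ.^ i) (f n) ⟨
    (ℤ.-1ℤ ℤ.^ suc i) ℤ.* f n         ∎
    where
    open ≡.≡-Reasoning
    s = (⊝ 𝟙) ^ i
    ⊝𝟙 : ⊝ 𝟙 ≗ scale ℤ.-1ℤ 𝟙
    ⊝𝟙 zero    = ≡.refl
    ⊝𝟙 (suc n) = ≡.refl

  coeff-Σ< : ∀ N F n → Σ< N F n ≡ Sums.Σ< ℤₚ.+-*-commutativeRing N (λ i → F i n)
  coeff-Σ< zero    F n = ≡.refl
  coeff-Σ< (suc N) F n = ≡.cong (ℤ._+ F N n) (coeff-Σ< N F n)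

-- Counting the partitions whose parts satisfy a predicate

≡ᵇ-refl : ∀ n → (n ≡ᵇ n) ≡ true
≡ᵇ-refl zero    = ≡.refl
≡ᵇ-refl (suc n) = ≡ᵇ-refl n

≢⇒≡ᵇ-false : ∀ {m n} → m ≢ n → (m ≡ᵇ n) ≡ false
≢⇒≡ᵇ-false {m} {n} m≢n with m ≡ᵇ n | ℕₚ.≡ᵇ⇒≡ m n
... | false | _ = ≡.refl
... | true  | f = ⊥-elim (m≢n (f _))

≤⇒≤ᵇ-true : ∀ {m n} → m ≤ n → (m ≤ᵇ n) ≡ true
≤⇒≤ᵇ-true {m} {n} m≤n with m ≤ᵇ n | ℕₚ.≤⇒≤ᵇ m≤n
... | true | _ = ≡.refl

>⇒≤ᵇ-false : ∀ {m n} → n < m → (m ≤ᵇ n) ≡ false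
>⇒≤ᵇ-false {m} {n} n<m with m ≤ᵇ n | ℕₚ.≤ᵇ⇒≤ m n
... | false | _ = ≡.refl
... | true  | f = ⊥-elim (ℕₚ.<⇒≱ n<m (f _))

module _ {A : Set} where
  countᵇ : (A → Bool) → List A → ℕ
  countᵇ p xs = length (filterᵇ p xs)

  countᵇ-++ : ∀ p xs ys → countᵇ p (xs ++ ys) ≡ countᵇ p xs ℕ.+ countᵇ p ys
  countᵇ-++ p xs ys = ≡.trans (≡.cong length (Listₚ.filter-++ _ xs ys)) (Listₚ.length-++ (filterᵇ p xs))

  countᵇ-cong : ∀ {p p′ : A → Bool} → p ≗ p′ → countᵇ p ≗ countᵇ p′
  countᵇ-cong p≗p′ [] = ≡.refl
  countᵇ-cong {p} {p′} p≗p′ (x ∷ xs) with p x | p′ x | p≗p′ x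
  ... | true  | _ | ≡.refl = ≡.cong suc (countᵇ-cong p≗p′ xs)
  ... | false | _ | ≡.refl = countᵇ-cong p≗p′ xs

  countᵇ-none : ∀ xs → countᵇ (λ _ → false) xs ≡ 0
  countᵇ-none []       = ≡.refl
  countᵇ-none (x ∷ xs) = countᵇ-none xs

countᵇ-map : ∀ {A B : Set} (p : B → Bool) (f : A → B) xs → countᵇ p (map f xs) ≡ countᵇ (p ∘ f) xs
countᵇ-map p f [] = ≡.refl
countᵇ-map p f (x ∷ xs) with p (f x)
... | true  = ≡.cong suc (countᵇ-map p f xs)
... | false = countᵇ-map p f xs

module Σℤ = Sums ℤₚ.+-*-commutativeRing
open Σℤ using () renaming (Σ< to Σℤ<)

-- Follows the shape of `partitionsLE`. Stated for `applyUpTo f` because the induction replaces f by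
-- `f ∘ suc`; `upTo` is the case of the identity.
countᵇ-concatMap : ∀ {A : Set} (p : A → Bool) (g : ℕ → List A) (r : ℕ → Bool) (f : ℕ → ℕ) N →
  + countᵇ p (concatMap g (filterᵇ r (applyUpTo f N)))
    ≡ Σℤ< N (λ i → if r (f i) then + countᵇ p (g (f i)) else 0ℤ)
countᵇ-concatMap p g r f zero = ≡.refl
countᵇ-concatMap p g r f (suc N) = ≡.trans head (≡.sym (Σℤ.Σ<-head N (λ i → if r (f i) then + countᵇ p (g (f i)) else 0ℤ)))
  where
  rest = concatMap g (filterᵇ r (applyUpTo (f ∘ suc) N))
  head : + countᵇ p (concatMap g (filterᵇ r (applyUpTo f (suc N)))) ≡
    (if r (f 0) then + countᵇ p (g (f 0)) else 0ℤ) ℤ.+ Σℤ< N (λ i → if r (f (suc i)) then + countᵇ p (g (f (suc i))) else 0ℤ)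
  head with r (f 0)
  ... | true  = ≡.trans (≡.cong +_ (countᵇ-++ p (g (f 0)) rest))
    (≡.trans (ℤₚ.pos-+ (countᵇ p (g (f 0))) (countᵇ p rest)) (≡.cong (ℤ._+_ (+ countᵇ p (g (f 0)))) (countᵇ-concatMap p g r (f ∘ suc) N)))
  ... | false = ≡.trans (countᵇ-concatMap p g r (f ∘ suc) N) (≡.sym (ℤₚ.+-identityˡ _))

all-replicate : ∀ (P : ℕ → Bool) {k} → P k ≡ true → ∀ c xs → all P (replicate c k ++ xs) ≡ all P xs
all-replicate P Pk zero    xs = ≡.refl
all-replicate P Pk (suc c) xs rewrite Pk = all-replicate P Pk c xs

partitionCount : (ℕ → Bool) → ℕ → ℕ → ℕ
partitionCount P k n = countᵇ (all P) (partitionsLE k n)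

partitionCount-split : ∀ P k n → + partitionCount P (suc k) n ≡
  Σℤ< (suc n) (λ c → if c ℕ.* suc k ≤ᵇ n
    then + countᵇ (all P) (map (replicate c (suc k) ++_) (partitionsLE k (n ℕ.∸ c ℕ.* suc k))) else 0ℤ)
partitionCount-split P k n = countᵇ-concatMap (all P)
  (λ c → map (replicate c (suc k) ++_) (partitionsLE k (n ℕ.∸ c ℕ.* suc k))) (λ c → c ℕ.* suc k ≤ᵇ n) (λ c → c) (suc n)

partitionCount-allowed : ∀ P k n → P (suc k) ≡ true → + partitionCount P (suc k) n ≡
  Σℤ< (suc n) (λ c → if c ℕ.* suc k ≤ᵇ n then + partitionCount P k (n ℕ.∸ c ℕ.* suc k) else 0ℤ)
partitionCount-allowed P k n allowed = ≡.trans (partitionCount-split P k n)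
  (Σℤ.Σ<-cong (suc n) (λ c _ → ≡.cong (λ t → if c ℕ.* suc k ≤ᵇ n then + t else 0ℤ)
    (≡.trans (countᵇ-map (all P) (replicate c (suc k) ++_) (partitionsLE k (n ℕ.∸ c ℕ.* suc k)))
             (countᵇ-cong (all-replicate P allowed c) (partitionsLE k (n ℕ.∸ c ℕ.* suc k))))))

-- Only multiplicity 0 survives, as otherwise the list starts with the forbidden part.
partitionCount-forbidden : ∀ P k n → P (suc k) ≡ false → partitionCount P (suc k) n ≡ partitionCount P k n
partitionCount-forbidden P k n forbidden = ℤₚ.+-injective (begin
  + partitionCount P (suc k) n                 ≡⟨ partitionCount-split P k n ⟩
  Σℤ< (suc n) term                             ≡⟨ Σℤ.Σ<-head n term ⟩
  term 0 ℤ.+ Σℤ< n (λ c → term (suc c))        ≡⟨ ≡.cong₂ ℤ._+_ (≡.cong +_ (countᵇ-map (all P) (λ xs → xs) (partitionsLE k n)))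
                                                     (≡.trans (Σℤ.Σ<-cong n (λ c _ → vanish c)) (Σℤ.Σ<-0 n)) ⟩
  + partitionCount P k n ℤ.+ 0ℤ                ≡⟨ ℤₚ.+-identityʳ _ ⟩
  + partitionCount P k n                       ∎)
  where
  open ≡.≡-Reasoning
  term : ℕ → ℤ
  term c = if c ℕ.* suc k ≤ᵇ n
    then + countᵇ (all P) (map (replicate c (suc k) ++_) (partitionsLE k (n ℕ.∸ c ℕ.* suc k))) else 0ℤ
  vanish : ∀ c → term (suc c) ≡ 0ℤ
  vanish c with suc c ℕ.* suc k ≤ᵇ n
  ... | false = ≡.refl
  ... | true  = ≡.cong +_ (≡.trans (countᵇ-map (all P) (replicate (suc c) (suc k) ++_) ps)
                 (≡.trans (countᵇ-cong (λ xs → ≡.cong (_∧ all P (replicate c (suc k) ++ xs)) forbidden) ps) (countᵇ-none ps)))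
    where ps = partitionsLE k (n ℕ.∸ suc c ℕ.* suc k)

partitionCount-suc : ∀ P {k n} → n ≤ k → partitionCount P (suc k) n ≡ partitionCount P k n
partitionCount-suc P {k} {n} n≤k with P (suc k) in eq
... | false = partitionCount-forbidden P k n eq
... | true  = ℤₚ.+-injective (begin
  + partitionCount P (suc k) n                 ≡⟨ partitionCount-allowed P k n eq ⟩
  Σℤ< (suc n) term                             ≡⟨ Σℤ.Σ<-head n term ⟩
  term 0 ℤ.+ Σℤ< n (λ c → term (suc c))        ≡⟨ ≡.cong (ℤ._+_ (term 0)) (≡.trans (Σℤ.Σ<-cong n (λ c _ → vanish c)) (Σℤ.Σ<-0 n)) ⟩
  + partitionCount P k n ℤ.+ 0ℤ                ≡⟨ ℤₚ.+-identityʳ _ ⟩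
  + partitionCount P k n                       ∎)
  where
  open ≡.≡-Reasoning
  term : ℕ → ℤ
  term c = if c ℕ.* suc k ≤ᵇ n then + partitionCount P k (n ℕ.∸ c ℕ.* suc k) else 0ℤ
  vanish : ∀ c → term (suc c) ≡ 0ℤ
  vanish c = ≡.cong (λ t → if t then + partitionCount P k (n ℕ.∸ suc c ℕ.* suc k) else 0ℤ)
    (>⇒≤ᵇ-false (ℕₚ.<-≤-trans (s≤s n≤k) (ℕₚ.m≤m+n (suc k) (c ℕ.* suc k))))

-- `partitions n` bounds parts by n itself, but a generating function needs one bound for all its
-- coefficients.
partitionCount-stable : ∀ P d n → partitionCount P (n ℕ.+ d) n ≡ partitionCount P n n
partitionCount-stable P zero    n = ≡.cong (λ k → partitionCount P k n) (ℕₚ.+-identityʳ n)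
partitionCount-stable P (suc d) n = ≡.trans (≡.cong (λ k → partitionCount P k n) (ℕₚ.+-suc n d))
  (≡.trans (partitionCount-suc P (ℕₚ.m≤m+n n d)) (partitionCount-stable P d n))

-- Literally the test inside `pNot`, so that `pNot` is definitionally a `partitionCount`.
allowed : (M : ℕ) .{{_ : NonZero M}} → ℕ → ℕ → ℕ → ℕ → Bool
allowed M a b c x = not (x % M ≡ᵇ a % M) ∧ not (x % M ≡ᵇ b % M) ∧ not (x % M ≡ᵇ c % M)

pNot-partitionCount : ∀ M .{{_ : NonZero M}} a b c {n K} → n ≤ K →
  partitionCount (allowed M a b c) K n ≡ pNot M a b c n
pNot-partitionCount M a b c {n} {K} n≤K =
  ≡.trans (≡.cong (λ k → partitionCount (allowed M a b c) k n) (≡.sym (ℕₚ.m+[n∸m]≡n n≤K)))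
          (partitionCount-stable (allowed M a b c) (K ℕ.∸ n) n)

-- Generating functions of restricted partitions as theta series

module GeneratingFunction (L : ℕ) where
  open PowerSeries
  open Truncated L using (below; ≗⇒≋; coeff-X^-∸; coeff-X^-<; coeff-Σ<; X^-vanish) renaming (ring to R)
  open CommutativeRing R hiding (zero)
  open IntegerCoefficients R
  open Solver using (solve; _:=_; _:*_)
  open Exp semiring
  open Sums R
  open Pochhammer R X
  open Nilpotent L (X^-vanish ℕₚ.≤-refl)
  open import Relation.Binary.Reasoning.Setoid setoid

  gf : (ℕ → Bool) → ℕ → Series
  gf P k n = + partitionCount P k n

  gf-zero : ∀ P → gf P 0 ≈ 1#
  gf-zero P = ≗⇒≋ λ { zero → ≡.refl ; (suc n) → ≡.refl }

  coeff-power : ∀ k c f n → (X ^ (c ℕ.* suc k) ⊛ f) n ≡ (if c ℕ.* suc k ≤ᵇ n then f (n ℕ.∸ c ℕ.* suc k) else 0ℤ)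
  coeff-power k c f n with ℕₚ.≤-<-connex (c ℕ.* suc k) n
  ... | inj₁ le rewrite ≤⇒≤ᵇ-true le = coeff-X^-∸ (c ℕ.* suc k) f le
  ... | inj₂ gt rewrite >⇒≤ᵇ-false gt = coeff-X^-< (c ℕ.* suc k) f n gt

  gf-allowed : ∀ P k → P (suc k) ≡ true → gf P (suc k) ≈ geometric k * gf P k
  gf-allowed P k ok = sym (begin
    geometric k * gf P k                                  ≈⟨ trans (*-comm _ _) (Σ<-distribˡ L (gf P k) _) ⟩
    Σ< L (λ c → gf P k * (X ^ suc k) ^ c)                 ≈⟨ Σ<-cong L (λ c _ → trans (*-comm _ _)
                                                               (*-congʳ (trans (^-assocʳ X (suc k) c) (^-congʳ X (ℕₚ.*-comm (suc k) c))))) ⟩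
    Σ< L (λ c → X ^ (c ℕ.* suc k) * gf P k)               ≈⟨ below coefficient ⟩
    gf P (suc k)                                          ∎)
    where
    coefficient : ∀ n → n < L → Σ< L (λ c → X ^ (c ℕ.* suc k) * gf P k) n ≡ gf P (suc k) n
    coefficient n n<L = E.begin
      Σ< L (λ c → X ^ (c ℕ.* suc k) * gf P k) n           E.≡⟨ coeff-Σ< L _ n ⟩
      Σℤ< L (λ c → (X ^ (c ℕ.* suc k) * gf P k) n)        E.≡⟨ Σℤ.Σ<-cong L (λ c _ → coeff-power k c (gf P k) n) ⟩
      -- The geometric series has L terms, the count n + 1; those with c > n vanish because c (k +
      -- 1) > n.
      Σℤ< L term                                          E.≡⟨ ≡.cong (λ t → Σℤ< t term) (ℕₚ.m+[n∸m]≡n n<L) ⟨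
      Σℤ< (suc n ℕ.+ (L ℕ.∸ suc n)) term                  E.≡⟨ Σℤ.Σ<-++ (suc n) (L ℕ.∸ suc n) term ⟩
      Σℤ< (suc n) term ℤ.+ Σℤ< (L ℕ.∸ suc n) (λ i → term (suc n ℕ.+ i))
        E.≡⟨ ≡.cong (ℤ._+_ (Σℤ< (suc n) term)) (≡.trans (Σℤ.Σ<-cong (L ℕ.∸ suc n) (λ i _ → vanish i)) (Σℤ.Σ<-0 (L ℕ.∸ suc n))) ⟩
      Σℤ< (suc n) term ℤ.+ 0ℤ                             E.≡⟨ ℤₚ.+-identityʳ _ ⟩
      Σℤ< (suc n) term                                    E.≡⟨ partitionCount-allowed P k n ok ⟨
      gf P (suc k) n                                      E.∎
      where
      module E = ≡.≡-Reasoning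
      term : ℕ → ℤ
      term c = if c ℕ.* suc k ≤ᵇ n then gf P k (n ℕ.∸ c ℕ.* suc k) else 0ℤ
      vanish : ∀ i → term (suc n ℕ.+ i) ≡ 0ℤ
      vanish i = ≡.cong (λ t → if t then gf P k (n ℕ.∸ (suc n ℕ.+ i) ℕ.* suc k) else 0ℤ)
        (>⇒≤ᵇ-false (ℕₚ.≤-trans (ℕₚ.m≤m+n (suc n) i) (ℕₚ.m≤m*n (suc n ℕ.+ i) (suc k))))

  -- Each allowed part contributes a geometric series that cancels its Euler factor, so the factors
  -- of the forbidden parts remain.
  poch-gf : ∀ P K → poch K * gf P K ≈ Π< K (λ i → if P (suc i) then 1# else 1# - X ^ suc i)
  poch-gf P zero    = trans (*-identityˡ _) (gf-zero P)
  poch-gf P (suc K) with P (suc K) in eq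
  ... | true  = begin
    poch K * (1# - X ^ suc K) * gf P (suc K)             ≈⟨ *-congˡ (gf-allowed P K eq) ⟩
    poch K * (1# - X ^ suc K) * (geometric K * gf P K)
      ≈⟨ solve 4 (λ p z g f → p :* z :* (g :* f) := (z :* g) :* (p :* f)) refl _ _ _ _ ⟩
    ((1# - X ^ suc K) * geometric K) * (poch K * gf P K) ≈⟨ *-cong (geometric-inverse K) (poch-gf P K) ⟩
    1# * Π< K _                                          ≈⟨ *-comm _ _ ⟩
    Π< K _ * 1#                                          ∎
  ... | false = begin
    poch K * (1# - X ^ suc K) * gf P (suc K)             ≈⟨ *-congˡ (≗⇒≋ (λ n → ≡.cong +_ (partitionCount-forbidden P K n eq))) ⟩
    poch K * (1# - X ^ suc K) * gf P K                   ≈⟨ solve 3 (λ p z f → p :* z :* f := (p :* f) :* z) refl _ _ _ ⟩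
    poch K * gf P K * (1# - X ^ suc K)                   ≈⟨ *-congʳ (poch-gf P K) ⟩
    Π< K _ * (1# - X ^ suc K)                            ∎

  Π<-single : ∀ n a (z : ℕ → Carrier) → a < n → Π< n (λ r → if r ≡ᵇ a then z r else 1#) ≈ z a
  Π<-single (suc n) a z (s≤s a≤n) with ℕₚ.m≤n⇒m<n∨m≡n a≤n
  ... | inj₁ a<n rewrite ≢⇒≡ᵇ-false (ℕₚ.>⇒≢ a<n) = trans (*-identityʳ _) (Π<-single n a z a<n)
  ... | inj₂ ≡.refl rewrite ≡ᵇ-refl n = trans (*-congʳ (trans (Π<-cong n others) (Π<-1 n))) (*-identityˡ _)
    where
    others : ∀ r → r < n → (if r ≡ᵇ n then z r else 1#) ≈ 1#
    others r r<n rewrite ≢⇒≡ᵇ-false (ℕₚ.<⇒≢ r<n) = refl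

  -- Index i stands for the part i + 1, so within a block of M indices the offsets c′, d′ and M′
  -- carry the residues c, d and 0. For c = d the triple product would contain a factor twice that
  -- the forbidden parts contain once; `c′≢d′` excludes this.
  module ForbiddenFactors (M′ c′ d′ : ℕ) (c+d≡M : suc c′ ℕ.+ suc d′ ≡ suc M′) (c′≢d′ : c′ ≢ d′) where
    M c d : ℕ
    M = suc M′
    c = suc c′
    d = suc d′

    c′<M′ : c′ < M′
    c′<M′ = ℕₚ.≤-trans (s≤s (ℕₚ.m≤m+n c′ d′)) (ℕₚ.≤-reflexive (≡.trans (≡.sym (ℕₚ.+-suc c′ d′)) (ℕₚ.suc-injective c+d≡M)))

    d′<M′ : d′ < M′
    d′<M′ = ℕₚ.≤-trans (ℕₚ.m≤n+m d c′) (ℕₚ.≤-reflexive (ℕₚ.suc-injective c+d≡M))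

    residue : ∀ j r → r < M → (suc (j ℕ.* M ℕ.+ r)) % M ≡ suc r % M
    residue j r r<M = ≡.trans (≡.cong (λ t → suc t % M) (ℕₚ.+-comm (j ℕ.* M) r)) ([m+kn]%n≡m%n (suc r) j M)

    factor : ℕ → Carrier
    factor i = if allowed M 0 c d (suc i) then 1# else 1# - X ^ suc i

    factor-inside : ∀ j r → r < M′ → factor (j ℕ.* M ℕ.+ r) ≈
      (if r ≡ᵇ c′ then 1# - X ^ suc (j ℕ.* M ℕ.+ r) else 1#) * (if r ≡ᵇ d′ then 1# - X ^ suc (j ℕ.* M ℕ.+ r) else 1#)
    factor-inside j r r<M′
      rewrite residue j r (ℕₚ.m<n⇒m<1+n r<M′) | m<n⇒m%n≡m {n = M} (s≤s r<M′) | m<n⇒m%n≡m (s≤s c′<M′) | m<n⇒m%n≡m (s≤s d′<M′)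
      with r ℕ.≟ c′
    ... | yes ≡.refl rewrite ≡ᵇ-refl r | ≢⇒≡ᵇ-false c′≢d′ = sym (*-identityʳ _)
    ... | no r≢c′ rewrite ≢⇒≡ᵇ-false r≢c′ with r ≡ᵇ d′
    ...   | true  = sym (*-identityˡ _)
    ...   | false = sym (*-identityˡ _)

    factor-last : ∀ j → factor (j ℕ.* M ℕ.+ M′) ≈ 1# - X ^ suc (j ℕ.* M ℕ.+ M′)
    factor-last j rewrite ≡.trans (residue j M′ ℕₚ.≤-refl) (n%n≡0 M) = refl

    Q : Carrier
    Q = X ^ M

    open Pochhammer R Q using () renaming (poch to pochQ)

    shift : ∀ j e → X ^ suc (j ℕ.* M ℕ.+ e) ≈ X ^ suc e * Q ^ j
    shift j e = begin
      X ^ suc (j ℕ.* M ℕ.+ e)      ≈⟨ ^-congʳ X (≡.cong suc (≡.trans (ℕₚ.+-comm (j ℕ.* M) e) (≡.cong (e ℕ.+_) (ℕₚ.*-comm j M)))) ⟩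
      X ^ (suc e ℕ.+ M ℕ.* j)      ≈⟨ ^-homo-* X (suc e) (M ℕ.* j) ⟩
      X ^ suc e * X ^ (M ℕ.* j)    ≈⟨ *-congˡ (^-assocʳ X M j) ⟨
      X ^ suc e * Q ^ j            ∎

    Π-factor : ∀ N → Π< (N ℕ.* M) factor ≈
      Π< N (λ i → 1# - X ^ c * Q ^ i) * Π< N (λ i → 1# - X ^ d * Q ^ i) * pochQ N
    Π-factor N = begin
      Π< (N ℕ.* M) factor
        ≈⟨ Π<-blocks M N factor ⟩
      Π< N (λ j → Π< M′ (λ r → factor (j ℕ.* M ℕ.+ r)) * factor (j ℕ.* M ℕ.+ M′))
        ≈⟨ Π<-cong N (λ j _ → block j) ⟩
      Π< N (λ j → (1# - X ^ c * Q ^ j) * (1# - X ^ d * Q ^ j) * (1# - Q ^ suc j))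
        ≈⟨ trans (Π<-* N _ _) (*-congʳ (Π<-* N _ _)) ⟩
      Π< N (λ i → 1# - X ^ c * Q ^ i) * Π< N (λ i → 1# - X ^ d * Q ^ i) * pochQ N ∎
      where
      block : ∀ j → Π< M′ (λ r → factor (j ℕ.* M ℕ.+ r)) * factor (j ℕ.* M ℕ.+ M′) ≈
        (1# - X ^ c * Q ^ j) * (1# - X ^ d * Q ^ j) * (1# - Q ^ suc j)
      block j = *-cong
        (trans (Π<-cong M′ (factor-inside j)) (trans (Π<-* M′ _ _)
          (*-cong (trans (Π<-single M′ c′ (λ r → 1# - X ^ suc (j ℕ.* M ℕ.+ r)) c′<M′) (1--cong (shift j c′)))
                  (trans (Π<-single M′ d′ (λ r → 1# - X ^ suc (j ℕ.* M ℕ.+ r)) d′<M′) (1--cong (shift j d′))))))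
        (trans (factor-last j) (1--cong (shift j M′)))

  open Theta R

  θ-product : ∀ M .{{_ : NonZero M}} c d → c ℕ.+ d ≡ M →
    Π< L (λ i → 1# - X ^ c * (X ^ M) ^ i) * Π< L (λ i → 1# - X ^ d * (X ^ M) ^ i) * Pochhammer.poch R (X ^ M) L
      ≈ Σ± L (θ-term (X ^ d) (X ^ c))
  θ-product M c d c+d≡M = TripleProduct.tripleProduct R (X ^ d) (X ^ c) (X ^ M)
    (trans (^-congʳ X (≡.trans (≡.sym c+d≡M) (ℕₚ.+-comm c d))) (^-homo-* X d c))
    L (trans (^-assocʳ X M L) (X^-vanish (ℕₚ.m≤n*m L M)))

  -- The product side is symmetric in c and d. Used because the order in which the two residues are
  -- listed depends on the sign of i.
  θ-swap : ∀ M .{{_ : NonZero M}} c d → c ℕ.+ d ≡ M → Σ± L (θ-term (X ^ d) (X ^ c)) ≈ Σ± L (θ-term (X ^ c) (X ^ d))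
  θ-swap M c d c+d≡M = trans (sym (θ-product M c d c+d≡M))
    (trans (*-congʳ (*-comm _ _)) (θ-product M d c (≡.trans (ℕₚ.+-comm d c) c+d≡M)))

  gf-θ : ∀ M .{{_ : NonZero M}} c d → 0 < c → 0 < d → c ℕ.+ d ≡ M → c ≢ d →
    poch (L ℕ.* M) * gf (allowed M 0 c d) (L ℕ.* M) ≈ Σ± L (θ-term (X ^ d) (X ^ c))
  gf-θ (suc M′) (suc c′) (suc d′) _ _ c+d≡M c≢d =
    trans (poch-gf (allowed (suc M′) 0 (suc c′) (suc d′)) (L ℕ.* suc M′))
    (trans (ForbiddenFactors.Π-factor M′ c′ d′ c+d≡M (c≢d ∘ ≡.cong suc) L) (θ-product (suc M′) (suc c′) (suc d′) c+d≡M))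

  -- The triple product at Q = q^3, x = q^2, y = q: the residues 1, 2, 0 modulo 3 exhaust all
  -- factors.
  pentagonal : ∀ N → L ≤ N → poch (N ℕ.* 3) ≈ Σ± N (θ-term (X ^ 2) (X ^ 1))
  pentagonal N L≤N = begin
    Π< (N ℕ.* 3) (λ i → 1# - X ^ suc i)
      ≈⟨ Π<-blocks 3 N _ ⟩
    Π< N (λ j → Π< 3 (λ r → 1# - X ^ suc (j ℕ.* 3 ℕ.+ r)))
      ≈⟨ Π<-cong N (λ j _ → trans (*-congʳ (*-congʳ (*-identityˡ _))) (*-cong (*-cong (factor j 0) (factor j 1)) (factor j 2))) ⟩
    Π< N (λ j → (1# - X ^ 1 * Q ^ j) * (1# - X ^ 2 * Q ^ j) * (1# - Q ^ suc j))
      ≈⟨ trans (Π<-* N _ _) (*-congʳ (Π<-* N _ _)) ⟩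
    Π< N (λ i → 1# - X ^ 1 * Q ^ i) * Π< N (λ i → 1# - X ^ 2 * Q ^ i) * Π< N (λ i → 1# - Q ^ suc i)
      ≈⟨ TripleProduct.tripleProduct R (X ^ 2) (X ^ 1) Q
           (^-homo-* X 2 1) N (trans (^-assocʳ X 3 N) (X^-vanish (ℕₚ.≤-trans L≤N (ℕₚ.m≤m+n N _)))) ⟩
    Σ± N (θ-term (X ^ 2) (X ^ 1)) ∎
    where
    Q = X ^ 3
    factor : ∀ j e → 1# - X ^ suc (j ℕ.* 3 ℕ.+ e) ≈ 1# - X ^ suc e * Q ^ j
    factor j e = 1--cong ((trans (^-congʳ X (≡.cong suc (≡.trans (ℕₚ.+-comm (j ℕ.* 3) e) (≡.cong (e ℕ.+_) (ℕₚ.*-comm j 3)))))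
      (trans (^-homo-* X (suc e) (3 ℕ.* j)) (*-congˡ (sym (^-assocʳ X 3 j))))))

-- Exponents and signs in the dissected pentagonal series

open import Data.Nat using (_+_; _*_; _∸_; _^_)

tri-double : ∀ n → 2 * tri n ≡ n * suc n
tri-double zero    = ≡.refl
tri-double (suc n) = ≡.trans (ℕₚ.*-distribˡ-+ 2 (suc n) (tri n)) (≡.trans (≡.cong (_+_ (2 * suc n)) (tri-double n))
  (solveℕ 1 (λ n → conℕ 2 *ⁿ (conℕ 1 +ⁿ n) +ⁿ n *ⁿ (conℕ 1 +ⁿ n) =ⁿ (conℕ 1 +ⁿ n) *ⁿ (conℕ 2 +ⁿ n)) ≡.refl n))

tri-doubleℤ : ∀ n → + 2 ℤ.* + tri n ≡ + n ℤ.* (+ n ℤ.+ 1ℤ)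
tri-doubleℤ n = ≡.trans (≡.sym (ℤₚ.pos-* 2 (tri n))) (≡.trans (≡.cong +_ (tri-double n))
  (≡.trans (ℤₚ.pos-* n (suc n)) (≡.cong (λ t → + n ℤ.* + t) (ℕₚ.+-comm 1 n))))

T-double : ∀ j → + 2 ℤ.* + T j ≡ j ℤ.* (j ℤ.+ 1ℤ)
T-double (+ n)    = tri-doubleℤ n
T-double -[1+ n ] = ≡.trans (tri-doubleℤ n)
  (solveℤ 1 (λ n → n *ᶻ (n +ᶻ conℤ 1ℤ) =ᶻ (-ᶻ (conℤ 1ℤ +ᶻ n)) *ᶻ ((-ᶻ (conℤ 1ℤ +ᶻ n)) +ᶻ conℤ 1ℤ)) ≡.refl (+ n))

-- The exponent of q in the theta term at x = q^a, y = q^b; `quadratic 2 1` is ω.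
quadratic : ℕ → ℕ → ℤ → ℕ
quadratic a b j = a * T j + b * T (ℤ.- j)

-- Doubling clears the halves, so identities between exponents become polynomial identities over ℤ.
quadratic-double : ∀ a b j → + 2 ℤ.* + quadratic a b j ≡ + a ℤ.* (j ℤ.* (j ℤ.+ 1ℤ)) ℤ.+ + b ℤ.* (j ℤ.* (j ℤ.- 1ℤ))
quadratic-double a b j = begin
  + 2 ℤ.* + quadratic a b j
    ≡⟨ ≡.cong (+ 2 ℤ.*_) (≡.trans (ℤₚ.pos-+ (a * T j) _) (≡.cong₂ ℤ._+_ (ℤₚ.pos-* a (T j)) (ℤₚ.pos-* b (T (ℤ.- j))))) ⟩
  + 2 ℤ.* (+ a ℤ.* + T j ℤ.+ + b ℤ.* + T (ℤ.- j))
    ≡⟨ solveℤ 4 (λ a s b t → conℤ (+ 2) *ᶻ (a *ᶻ s +ᶻ b *ᶻ t) =ᶻ a *ᶻ (conℤ (+ 2) *ᶻ s) +ᶻ b *ᶻ (conℤ (+ 2) *ᶻ t)) ≡.refl (+ a) (+ T j) (+ b) (+ T (ℤ.- j)) ⟩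
  + a ℤ.* (+ 2 ℤ.* + T j) ℤ.+ + b ℤ.* (+ 2 ℤ.* + T (ℤ.- j))
    ≡⟨ ≡.cong₂ (λ s t → + a ℤ.* s ℤ.+ + b ℤ.* t) (T-double j) (T-double (ℤ.- j)) ⟩
  + a ℤ.* (j ℤ.* (j ℤ.+ 1ℤ)) ℤ.+ + b ℤ.* ((ℤ.- j) ℤ.* ((ℤ.- j) ℤ.+ 1ℤ))
    ≡⟨ solveℤ 3 (λ a b j → a *ᶻ (j *ᶻ (j +ᶻ conℤ 1ℤ)) +ᶻ b *ᶻ ((-ᶻ j) *ᶻ ((-ᶻ j) +ᶻ conℤ 1ℤ))
                     =ᶻ a *ᶻ (j *ᶻ (j +ᶻ conℤ 1ℤ)) +ᶻ b *ᶻ (j *ᶻ (j -ᶻ conℤ 1ℤ))) ≡.refl (+ a) (+ b) j ⟩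
  + a ℤ.* (j ℤ.* (j ℤ.+ 1ℤ)) ℤ.+ + b ℤ.* (j ℤ.* (j ℤ.- 1ℤ)) ∎
  where open ≡.≡-Reasoning

-- The exponent of the theta series attached to the residue class of i = r - m modulo k = 2m + 1.
quadratic-dissect : ∀ m r r′ j → r + r′ ≡ m + m → let k = suc (m + m) in
  quadratic 2 1 (j ℤ.* + k ℤ.+ (r ⊖ m)) ≡ quadratic 2 1 (r ⊖ m) + quadratic (k * (3 * r + 2)) (k * (3 * r′ + 1)) j
quadratic-dissect m r r′ j r+r′≡2m = ℤₚ.+-injective (ℤₚ.*-cancelˡ-≡ (+ 2) _ _ (begin
  + 2 ℤ.* + quadratic 2 1 z
    ≡⟨ quadratic-double 2 1 z ⟩
  + 2 ℤ.* (z ℤ.* (z ℤ.+ 1ℤ)) ℤ.+ + 1 ℤ.* (z ℤ.* (z ℤ.- 1ℤ))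
    ≡⟨ ≡.cong (λ i → + 2 ℤ.* ((j ℤ.* + k ℤ.+ i) ℤ.* (j ℤ.* + k ℤ.+ i ℤ.+ 1ℤ)) ℤ.+ + 1 ℤ.* ((j ℤ.* + k ℤ.+ i) ℤ.* (j ℤ.* + k ℤ.+ i ℤ.- 1ℤ))) i≡ ⟩
  -- Doubled, ω(jκ + ι) - ω(ι) is 3κ² j² + κ(6ι + 1) j. These coefficients are the sum and the
  -- difference of κ(3r + 2) and κ(3ρ + 1), which explains the two residues.
  _ ≡⟨ solveℤ 3 (λ m r j → let one = conℤ 1ℤ ; two = conℤ (+ 2) ; three = conℤ (+ 3)
                               κ = one +ᶻ (m +ᶻ m) ; ρ = m +ᶻ m -ᶻ r ; ι = r -ᶻ m ; ζ = j *ᶻ κ +ᶻ ι in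
         two *ᶻ (ζ *ᶻ (ζ +ᶻ one)) +ᶻ one *ᶻ (ζ *ᶻ (ζ -ᶻ one))
         =ᶻ (two *ᶻ (ι *ᶻ (ι +ᶻ one)) +ᶻ one *ᶻ (ι *ᶻ (ι -ᶻ one)))
           +ᶻ ((κ *ᶻ (three *ᶻ r +ᶻ two)) *ᶻ (j *ᶻ (j +ᶻ one)) +ᶻ (κ *ᶻ (three *ᶻ ρ +ᶻ one)) *ᶻ (j *ᶻ (j -ᶻ one))))
       ≡.refl (+ m) (+ r) j ⟩
  _ ≡⟨ ≡.cong₂ (λ a b → (+ 2 ℤ.* (i ℤ.* (i ℤ.+ 1ℤ)) ℤ.+ + 1 ℤ.* (i ℤ.* (i ℤ.- 1ℤ)))
                 ℤ.+ (a ℤ.* (j ℤ.* (j ℤ.+ 1ℤ)) ℤ.+ b ℤ.* (j ℤ.* (j ℤ.- 1ℤ)))) a≡ b≡ ⟨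
  (+ 2 ℤ.* (i ℤ.* (i ℤ.+ 1ℤ)) ℤ.+ + 1 ℤ.* (i ℤ.* (i ℤ.- 1ℤ)))
    ℤ.+ (+ (k * (3 * r + 2)) ℤ.* (j ℤ.* (j ℤ.+ 1ℤ)) ℤ.+ + (k * (3 * r′ + 1)) ℤ.* (j ℤ.* (j ℤ.- 1ℤ)))
    ≡⟨ ≡.cong₂ ℤ._+_ (quadratic-double 2 1 i) (quadratic-double (k * (3 * r + 2)) (k * (3 * r′ + 1)) j) ⟨
  + 2 ℤ.* + quadratic 2 1 i ℤ.+ + 2 ℤ.* + Θ
    ≡⟨ ℤₚ.*-distribˡ-+ (+ 2) (+ quadratic 2 1 i) (+ Θ) ⟨
  + 2 ℤ.* (+ quadratic 2 1 i ℤ.+ + Θ)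
    ≡⟨ ≡.cong (λ i → + 2 ℤ.* (+ quadratic 2 1 i ℤ.+ + Θ)) i≡ ⟨
  + 2 ℤ.* (+ quadratic 2 1 (r ⊖ m) ℤ.+ + Θ)
    ≡⟨ ≡.cong (+ 2 ℤ.*_) (ℤₚ.pos-+ (quadratic 2 1 (r ⊖ m)) Θ) ⟨
  + 2 ℤ.* + (quadratic 2 1 (r ⊖ m) + Θ) ∎))
  where
  open ≡.≡-Reasoning
  k = suc (m + m)
  z = j ℤ.* + k ℤ.+ (r ⊖ m)
  i = + r ℤ.- + m
  Θ = quadratic (k * (3 * r + 2)) (k * (3 * r′ + 1)) j
  i≡ : r ⊖ m ≡ i
  i≡ = ≡.sym (ℤₚ.m-n≡m⊖n r m)
  r′≡ : + r′ ≡ + m ℤ.+ + m ℤ.- + r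
  r′≡ = ≡.trans (solveℤ 2 (λ r s → s =ᶻ (r +ᶻ s) -ᶻ r) ≡.refl (+ r) (+ r′))
    (≡.cong (ℤ._- + r) (≡.trans (≡.sym (ℤₚ.pos-+ r r′)) (≡.trans (≡.cong +_ r+r′≡2m) (ℤₚ.pos-+ m m))))
  cast : ∀ s e → + (k * (3 * s + e)) ≡ (1ℤ ℤ.+ (+ m ℤ.+ + m)) ℤ.* (+ 3 ℤ.* + s ℤ.+ + e)
  cast s e = ≡.trans (ℤₚ.pos-* k (3 * s + e)) (≡.cong (+ k ℤ.*_) (≡.trans (ℤₚ.pos-+ (3 * s) e) (≡.cong (ℤ._+ + e) (ℤₚ.pos-* 3 s))))
  a≡ : + (k * (3 * r + 2)) ≡ (1ℤ ℤ.+ (+ m ℤ.+ + m)) ℤ.* (+ 3 ℤ.* + r ℤ.+ + 2)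
  a≡ = cast r 2
  b≡ : + (k * (3 * r′ + 1)) ≡ (1ℤ ℤ.+ (+ m ℤ.+ + m)) ℤ.* (+ 3 ℤ.* (+ m ℤ.+ + m ℤ.- + r) ℤ.+ + 1)
  b≡ = ≡.trans (cast r′ 1) (≡.cong (λ t → (1ℤ ℤ.+ (+ m ℤ.+ + m)) ℤ.* (+ 3 ℤ.* t ℤ.+ + 1)) r′≡)

module Signs {c ℓ} (R : CommutativeRing c ℓ) where
  open CommutativeRing R using (Carrier; _≈_; -_; 1#; semiring; setoid; refl; sym; trans; reflexive; *-congˡ; *-congʳ; *-cong; *-comm; *-identityʳ)
    renaming (_*_ to _·_)
  open IntegerCoefficients R
  open Solver using (solve; _:=_; con; _:*_; :-_)
  open Exp semiring renaming (_^_ to _^ʳ_)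
  open Theta R
  open import Relation.Binary.Reasoning.Setoid setoid

  sgn : ℕ → Carrier
  sgn n = (- 1#) ^ʳ n

  -- |m - n| and m + n have the same parity.
  sgn-⊖ : ∀ m n → sgn ℤ.∣ m ⊖ n ∣ ≈ sgn m · sgn n
  sgn-⊖ m       zero    = sym (*-identityʳ _)
  sgn-⊖ zero    (suc n) = solve 1 (λ s → s := con (+ 1) :* s) refl _
  sgn-⊖ (suc m) (suc n) = begin
    sgn ℤ.∣ suc m ⊖ suc n ∣              ≡⟨ ≡.cong (sgn ∘ ℤ.∣_∣) (ℤₚ.[1+m]⊖[1+n]≡m⊖n m n) ⟩
    sgn ℤ.∣ m ⊖ n ∣                      ≈⟨ sgn-⊖ m n ⟩
    sgn m · sgn n                        ≈⟨ solve 2 (λ s t → s :* t := (:- con (+ 1) :* s) :* (:- con (+ 1) :* t)) refl _ _ ⟩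
    sgn (suc m) · sgn (suc n)            ∎

  sgn-+ : ∀ i j → sgn ℤ.∣ i ℤ.+ j ∣ ≈ sgn ℤ.∣ i ∣ · sgn ℤ.∣ j ∣
  sgn-+ (+ m)    (+ n)    = ^-homo-* (- 1#) m n
  sgn-+ (+ m)    -[1+ n ] = sgn-⊖ m (suc n)
  sgn-+ -[1+ m ] (+ n)    = trans (sgn-⊖ n (suc m)) (*-comm _ _)
  sgn-+ -[1+ m ] -[1+ n ] = trans (reflexive (≡.cong (sgn ∘ suc) (≡.sym (ℕₚ.+-suc m n)))) (^-homo-* (- 1#) (suc m) (suc n))

  -- Oddness of k = 2m + 1 makes the sign of jk + i split as (-1)^j (-1)^i, so each residue class
  -- yields an alternating theta series again.
  sgn-*odd : ∀ m n → sgn (n * suc (m + m)) ≈ sgn n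
  sgn-*odd m zero    = refl
  sgn-*odd m (suc n) = begin
    sgn (suc (m + m) + n * suc (m + m))                  ≈⟨ ^-homo-* (- 1#) (suc (m + m)) _ ⟩
    sgn (suc (m + m)) · sgn (n * suc (m + m))            ≈⟨ *-cong (*-congˡ (trans (^-homo-* (- 1#) m m) (sym (sgn-⊖ m m)))) (sgn-*odd m n) ⟩
    - 1# · sgn ℤ.∣ m ⊖ m ∣ · sgn n                       ≡⟨ ≡.cong (λ t → - 1# · sgn ℤ.∣ t ∣ · sgn n) (ℤₚ.n⊖n≡0 m) ⟩
    - 1# · 1# · sgn n                                    ≈⟨ *-congʳ (*-identityʳ _) ⟩
    - 1# · sgn n                                         ∎

  θ-power : ∀ q a b j → θ-term (q ^ʳ a) (q ^ʳ b) j ≈ sgn ℤ.∣ j ∣ · q ^ʳ quadratic a b j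
  θ-power q a b j = *-congˡ (trans (*-cong (^-assocʳ q a (T j)) (^-assocʳ q b (T (ℤ.- j)))) (sym (^-homo-* q (a * T j) _)))

  θ-dissect : ∀ q m r r′ j → r + r′ ≡ m + m → let k = suc (m + m) in
    θ-term (q ^ʳ 2) (q ^ʳ 1) (j ℤ.* + k ℤ.+ (r ⊖ m)) ≈
    θ-term (q ^ʳ 2) (q ^ʳ 1) (r ⊖ m) · θ-term (q ^ʳ (k * (3 * r + 2))) (q ^ʳ (k * (3 * r′ + 1))) j
  θ-dissect q m r r′ j r+r′≡2m = begin
    θ-term (q ^ʳ 2) (q ^ʳ 1) z
      ≈⟨ θ-power q 2 1 z ⟩
    sgn ℤ.∣ z ∣ · q ^ʳ quadratic 2 1 z
      ≈⟨ *-cong (trans (sgn-+ (j ℤ.* + k) i) (*-congʳ (trans (reflexive (≡.cong sgn (ℤₚ.abs-* j (+ k)))) (sgn-*odd m ℤ.∣ j ∣))))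
                (trans (^-congʳ q (quadratic-dissect m r r′ j r+r′≡2m)) (^-homo-* q (quadratic 2 1 i) _)) ⟩
    (sgn ℤ.∣ j ∣ · sgn ℤ.∣ i ∣) · (q ^ʳ quadratic 2 1 i · q ^ʳ quadratic a b j)
      ≈⟨ solve 4 (λ s t u v → (s :* t) :* (u :* v) := (t :* u) :* (s :* v)) refl _ _ _ _ ⟩
    (sgn ℤ.∣ i ∣ · q ^ʳ quadratic 2 1 i) · (sgn ℤ.∣ j ∣ · q ^ʳ quadratic a b j)
      ≈⟨ *-cong (θ-power q 2 1 i) (θ-power q a b j) ⟨
    θ-term (q ^ʳ 2) (q ^ʳ 1) i · θ-term (q ^ʳ a) (q ^ʳ b) j ∎
    where
    k = suc (m + m)
    i = r ⊖ m
    z = j ℤ.* + k ℤ.+ i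
    a = k * (3 * r + 2)
    b = k * (3 * r′ + 1)

-- A crude bound, enough to make the pentagonal terms with |j| ≥ L vanish.
∣j∣≤pentagonal : ∀ j → ℤ.∣ j ∣ ≤ quadratic 2 1 j
∣j∣≤pentagonal (+ n)    = ℕₚ.≤-trans (n≤tri n) (ℕₚ.≤-trans (ℕₚ.m≤m+n (tri n) _) (ℕₚ.m≤m+n (2 * tri n) _))
∣j∣≤pentagonal -[1+ n ] = ℕₚ.≤-trans (n≤tri (suc n)) (ℕₚ.≤-trans (ℕₚ.m≤m+n (tri (suc n)) _) (ℕₚ.m≤n+m (1 * tri (suc n)) _))

half : ∀ {a b} → a ≡ 2 * b → a / 2 ≡ b
half {b = b} ≡.refl = ≡.trans (≡.cong (_/ 2) (ℕₚ.*-comm 2 b)) (m*n/n≡m b 2)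

pentagonal⁺ : ∀ p → p * (3 * p + 1) / 2 ≡ quadratic 2 1 (+ p)
pentagonal⁺ zero = ≡.refl
pentagonal⁺ (suc q) = half (≡.sym (begin
  2 * (2 * tri (suc q) + 1 * tri q)        ≡⟨ solveℕ 2 (λ s t → conℕ 2 *ⁿ (conℕ 2 *ⁿ s +ⁿ conℕ 1 *ⁿ t) =ⁿ conℕ 2 *ⁿ (conℕ 2 *ⁿ s) +ⁿ conℕ 2 *ⁿ t) ≡.refl (tri (suc q)) (tri q) ⟩
  2 * (2 * tri (suc q)) + 2 * tri q        ≡⟨ ≡.cong₂ (λ s t → 2 * s + t) (tri-double (suc q)) (tri-double q) ⟩
  2 * (suc q * suc (suc q)) + q * suc q    ≡⟨ solveℕ 1 (λ q → conℕ 2 *ⁿ ((conℕ 1 +ⁿ q) *ⁿ (conℕ 2 +ⁿ q)) +ⁿ q *ⁿ (conℕ 1 +ⁿ q)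
                                                =ⁿ (conℕ 1 +ⁿ q) *ⁿ (conℕ 3 *ⁿ (conℕ 1 +ⁿ q) +ⁿ conℕ 1)) ≡.refl q ⟩
  suc q * (3 * suc q + 1)                  ∎))
  where open ≡.≡-Reasoning

pentagonal⁻ : ∀ q → suc q * (3 * suc q ∸ 1) / 2 ≡ quadratic 2 1 -[1+ q ]
pentagonal⁻ q = half (≡.sym (begin
  2 * (2 * tri q + 1 * tri (suc q))        ≡⟨ solveℕ 2 (λ s t → conℕ 2 *ⁿ (conℕ 2 *ⁿ s +ⁿ conℕ 1 *ⁿ t) =ⁿ conℕ 2 *ⁿ (conℕ 2 *ⁿ s) +ⁿ conℕ 2 *ⁿ t) ≡.refl (tri q) (tri (suc q)) ⟩
  -- The nested sum on the solver's right side is what `3 * suc q ∸ 1` reduces to.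
  2 * (2 * tri q) + 2 * tri (suc q)        ≡⟨ ≡.cong₂ (λ s t → 2 * s + t) (tri-double q) (tri-double (suc q)) ⟩
  2 * (q * suc q) + suc q * suc (suc q)    ≡⟨ solveℕ 1 (λ q → conℕ 2 *ⁿ (q *ⁿ (conℕ 1 +ⁿ q)) +ⁿ (conℕ 1 +ⁿ q) *ⁿ (conℕ 2 +ⁿ q)
                                                =ⁿ (conℕ 1 +ⁿ q) *ⁿ (q +ⁿ ((conℕ 1 +ⁿ q) +ⁿ ((conℕ 1 +ⁿ q) +ⁿ conℕ 0)))) ≡.refl q ⟩
  suc q * (3 * suc q ∸ 1)                  ∎))
  where open ≡.≡-Reasoning

3r+2≢3s+1 : ∀ r s → 3 * r + 2 ≢ 3 * s + 1
3r+2≢3s+1 r s eq with ≡.trans (≡.sym (mod3 r 2)) (≡.trans (≡.cong (_% 3) eq) (mod3 s 1))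
  where
  mod3 : ∀ r e → (3 * r + e) % 3 ≡ e % 3
  mod3 r e = ≡.trans (≡.cong (_% 3) (≡.trans (ℕₚ.+-comm (3 * r) e) (≡.cong (_+_ e) (ℕₚ.*-comm 3 r)))) ([m+kn]%n≡m%n e r 3)
... | ()

-- The recurrence for fixed m and n

module Recurrence (m n : ℕ) (1≤m : 1 ≤ m) (pent≤n : m * (3 * m + 1) / 2 ≤ n) where
  k M L : ℕ
  k = 2 * m + 1
  M = 3 * k ^ 2
  -- The coefficient of q^n is the last one kept.
  L = suc n

  instance
    M≢0 : NonZero M
    M≢0 = modulusNonZero m

  open PowerSeries
  open Truncated L using (coeff; X^-vanish; coeff-sign; coeff-X^-∸) renaming (ring to R)
  open CommutativeRing R using (Carrier; _≈_; 0#; 1#; refl; sym; trans; reflexive; semiring; setoid; *-congˡ; *-congʳ; *-assoc; *-identityˡ; zeroʳ)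
    renaming (_*_ to _·_)
  open Exp semiring renaming (_^_ to _^ʳ_)
  open Sums R
  open Theta R
  open Signs R
  open GeneratingFunction L
  open Pochhammer R X
  open Nilpotent L (X^-vanish ℕₚ.≤-refl)
  open IntegerCoefficients R
  open Solver using (solve; _:=_; _:*_)

  k≡ : k ≡ suc (m + m)
  k≡ = solveℕ 1 (λ m → conℕ 2 *ⁿ m +ⁿ conℕ 1 =ⁿ conℕ 1 +ⁿ (m +ⁿ m)) ≡.refl m

  pent : ℤ → Carrier
  pent = θ-term (X ^ʳ 2) (X ^ʳ 1)

  E : Carrier
  E = poch (L * M)

  term : ℤ → Carrier
  term (+ p)    = gf (allowed M 0 (k * (3 * m ∸ 3 * p + 1)) (k * (3 * m + 3 * p + 2))) (L * M)
  term -[1+ p ] = gf (allowed M 0 (k * (3 * m ∸ 3 * suc p + 2)) (k * (3 * m + 3 * suc p + 1))) (L * M)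

  pent-vanish : ∀ j → L ≤ ℤ.∣ j ∣ → pent j ≈ 0#
  pent-vanish j L≤ = trans (θ-power X 2 1 j)
    (trans (*-congˡ (X^-vanish (ℕₚ.≤-trans L≤ (∣j∣≤pentagonal j)))) (zeroʳ _))

  -- The theta series of the class i, with r = m + i and r′ = m - i, both natural.
  θ′ : ℕ → ℕ → ℤ → Carrier
  θ′ r r′ = θ-term (X ^ʳ (k * (3 * r + 2))) (X ^ʳ (k * (3 * r′ + 1)))

  L*k²≥L : L ≤ L * k ^ 2
  L*k²≥L = ℕₚ.m≤m*n L (k ^ 2) {{k²≢0}}
    where
    k²≢0 : NonZero (k ^ 2)
    k²≢0 rewrite k≡ = _

  Σ±-pent : ∀ N → L ≤ N → Σ± N pent ≈ Σ± L pent
  Σ±-pent N L≤N = trans (reflexive (≡.cong (λ N → Σ± N pent) (≡.sym (ℕₚ.m+[n∸m]≡n L≤N)))) (Σ±-stable L pent pent-vanish (N ∸ L))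

  -- The pentagonal series arrives with window L k², shrinks to L, and grows to L k + m, the window
  -- that splits evenly into residue classes.
  E-dissected : E ≈ Σ± m (λ i → Σ± L (λ j → pent (j ℤ.* + suc (m + m) ℤ.+ i)))
  E-dissected = begin
    poch (L * M)                                  ≡⟨ ≡.cong poch (solveℕ 2 (λ L s → L *ⁿ (conℕ 3 *ⁿ s) =ⁿ (L *ⁿ s) *ⁿ conℕ 3) ≡.refl L (k ^ 2)) ⟩
    poch ((L * k ^ 2) * 3)                        ≈⟨ pentagonal (L * k ^ 2) L*k²≥L ⟩
    Σ± (L * k ^ 2) pent                           ≈⟨ Σ±-pent (L * k ^ 2) L*k²≥L ⟩
    Σ± L pent                                     ≈⟨ Σ±-pent (L * suc (m + m) + m) (ℕₚ.≤-trans (ℕₚ.m≤m*n L (suc (m + m))) (ℕₚ.m≤m+n _ m)) ⟨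
    Σ± (L * suc (m + m) + m) pent                 ≈⟨ Σ±-dissect m L pent ⟩
    Σ± m (λ i → Σ± L (λ j → pent (j ℤ.* + suc (m + m) ℤ.+ i))) ∎
    where open import Relation.Binary.Reasoning.Setoid setoid

  module _ (r r′ : ℕ) (r+r′≡2m : r + r′ ≡ m + m) where
    residues-sum : k * (3 * r′ + 1) + k * (3 * r + 2) ≡ M
    residues-sum = begin
      k * (3 * r′ + 1) + k * (3 * r + 2)   ≡⟨ solveℕ 3 (λ k r s → k *ⁿ (conℕ 3 *ⁿ s +ⁿ conℕ 1) +ⁿ k *ⁿ (conℕ 3 *ⁿ r +ⁿ conℕ 2)
                                                 =ⁿ conℕ 3 *ⁿ (k *ⁿ ((conℕ 1 +ⁿ (r +ⁿ s)) *ⁿ conℕ 1))) ≡.refl k r r′ ⟩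
      3 * (k * (suc (r + r′) * 1))         ≡⟨ ≡.cong (λ t → 3 * (k * (t * 1))) (≡.trans (≡.cong suc r+r′≡2m) (≡.sym k≡)) ⟩
      M                                    ∎
      where open ≡.≡-Reasoning

    k-positive : ∀ s e → 0 < k * (3 * s + suc e)
    k-positive s e rewrite k≡ | ℕₚ.+-suc (3 * s) e = s≤s z≤n

    residues-distinct : k * (3 * r + 2) ≢ k * (3 * r′ + 1)
    residues-distinct eq = 3r+2≢3s+1 r r′ (ℕₚ.*-cancelˡ-≡ (3 * r + 2) (3 * r′ + 1) k {{k≢0}} eq)
      where
      k≢0 : NonZero k
      k≢0 rewrite k≡ = _

    E-gf⁺ : E · gf (allowed M 0 (k * (3 * r′ + 1)) (k * (3 * r + 2))) (L * M) ≈ Σ± L (θ′ r r′)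
    E-gf⁺ = gf-θ M _ _ (k-positive r′ 0) (k-positive r 1) residues-sum (residues-distinct ∘ ≡.sym)

    E-gf⁻ : E · gf (allowed M 0 (k * (3 * r + 2)) (k * (3 * r′ + 1))) (L * M) ≈ Σ± L (θ′ r r′)
    E-gf⁻ = trans (gf-θ M _ _ (k-positive r 1) (k-positive r′ 0) sum′ residues-distinct) (θ-swap M (k * (3 * r + 2)) (k * (3 * r′ + 1)) sum′)
      where sum′ = ≡.trans (ℕₚ.+-comm (k * (3 * r + 2)) _) residues-sum

    inner-sum : Σ± L (λ j → pent (j ℤ.* + suc (m + m) ℤ.+ (r ⊖ m))) ≈ pent (r ⊖ m) · Σ± L (θ′ r r′)
    inner-sum = trans (Σ<-cong (suc (L + L)) (λ t _ → trans (θ-dissect X m r r′ (t ⊖ L) r+r′≡2m)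
        (reflexive (≡.cong (λ κ → pent (r ⊖ m) · θ-term (X ^ʳ (κ * (3 * r + 2))) (X ^ʳ (κ * (3 * r′ + 1))) (t ⊖ L)) (≡.sym k≡)))))
      (sym (Σ<-distribˡ (suc (L + L)) (pent (r ⊖ m)) _))

  -- The sign of i = r - m selects one of the two families in the statement. From r + r′ = 2m it
  -- follows that |i| ≤ m, so the truncated subtraction in the residue is exact.
  E-term : ∀ r r′ → r + r′ ≡ m + m → E · term (r ⊖ m) ≈ Σ± L (θ′ r r′)
  E-term r r′ r+r′≡2m with ≤-or-> m r
  ... | inj₁ (p , ≡.refl) rewrite [m+n]⊖m≡n m p = trans (reflexive (≡.cong₂ (λ c d → E · gf (allowed M 0 (k * (c + 1)) (k * (d + 2))) (L * M)) c≡ d≡)) (E-gf⁺ r r′ r+r′≡2m)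
    where
    m≡p+r′ : m ≡ p + r′
    m≡p+r′ = ℕₚ.+-cancelˡ-≡ m m (p + r′) (≡.trans (≡.sym r+r′≡2m) (ℕₚ.+-assoc m p r′))
    c≡ : 3 * m ∸ 3 * p ≡ 3 * r′
    c≡ = ≡.trans (≡.sym (ℕₚ.*-distribˡ-∸ 3 m p)) (≡.cong (3 *_) (≡.trans (≡.cong (_∸ p) m≡p+r′) (ℕₚ.m+n∸m≡n p r′)))
    d≡ : 3 * m + 3 * p ≡ 3 * (m + p)
    d≡ = ≡.sym (ℕₚ.*-distribˡ-+ 3 m p)
  ... | inj₂ (p , m≡) = trans (reflexive (≡.trans (≡.cong (λ t → E · term t) r⊖m) (≡.cong₂ (λ c d → E · gf (allowed M 0 (k * (c + 2)) (k * (d + 1))) (L * M)) c≡ d≡))) (E-gf⁻ r r′ r+r′≡2m)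
    where
    m≡r+1+p : m ≡ r + suc p
    m≡r+1+p = ≡.trans m≡ (≡.sym (ℕₚ.+-suc r p))
    r⊖m : r ⊖ m ≡ -[1+ p ]
    r⊖m = ≡.trans (≡.cong (r ⊖_) m≡r+1+p) (m⊖[m+n]≡-n r (suc p))
    c≡ : 3 * m ∸ 3 * suc p ≡ 3 * r
    c≡ = ≡.trans (≡.sym (ℕₚ.*-distribˡ-∸ 3 m (suc p))) (≡.cong (3 *_) (≡.trans (≡.cong (_∸ suc p) m≡r+1+p) (ℕₚ.m+n∸n≡m r (suc p))))
    r′≡ : m + suc p ≡ r′
    r′≡ = ℕₚ.+-cancelˡ-≡ r (m + suc p) r′ (≡.trans (≡.cong (_+_ r) (ℕₚ.+-comm m (suc p)))
      (≡.trans (≡.sym (ℕₚ.+-assoc r (suc p) m)) (≡.trans (≡.cong (_+ m) (≡.sym m≡r+1+p)) (≡.sym r+r′≡2m))))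
    d≡ : 3 * m + 3 * suc p ≡ 3 * r′
    d≡ = ≡.trans (≡.sym (ℕₚ.*-distribˡ-+ 3 m (suc p))) (≡.cong (3 *_) r′≡)

  alternatingSum : Σ± m (λ i → pent i · term i) ≈ 1#
  alternatingSum = begin
    S                                  ≈⟨ *-identityˡ S ⟨
    1# · S                             ≈⟨ *-congʳ (poch-inverse (L * M)) ⟨
    (E · poch⁻¹ (L * M)) · S           ≈⟨ solve 3 (λ e e′ s → (e :* e′) :* s := (e :* s) :* e′) refl _ _ _ ⟩
    (E · S) · poch⁻¹ (L * M)           ≈⟨ *-congʳ E·S≈E ⟩
    E · poch⁻¹ (L * M)                 ≈⟨ poch-inverse (L * M) ⟩
    1#                                 ∎
    where
    open import Relation.Binary.Reasoning.Setoid setoid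
    S = Σ± m (λ i → pent i · term i)
    E·S≈E : E · S ≈ E
    E·S≈E = trans (Σ<-distribˡ (suc (m + m)) E _) (trans
      (Σ<-cong (suc (m + m)) (λ { r (s≤s r≤2m) → let r+r′ = ℕₚ.m+[n∸m]≡n r≤2m in trans
        (solve 3 (λ e p t → e :* (p :* t) := p :* (e :* t)) refl _ _ _)
        (trans (*-congˡ (E-term r (m + m ∸ r) r+r′)) (sym (inner-sum r (m + m ∸ r) r+r′))) }))
      (sym E-dissected))

  -- The pentagonal term is a signed power q^e, hence a shift; `e ≤ n` keeps `n ∸ e` a true
  -- difference.
  coeff-summand : ∀ i {e} → e ≡ quadratic 2 1 i → e ≤ n →
    (pent i · term i) n ≡ (-1ℤ ℤ.^ ℤ.∣ i ∣) ℤ.* term i (n ∸ e)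
  coeff-summand i ≡.refl e≤n = begin
    (pent i · term i) n                             ≡⟨ coeff (trans (*-congʳ (θ-power X 2 1 i)) (*-assoc _ _ _)) n ℕₚ.≤-refl ⟩
    (sgn ℤ.∣ i ∣ · (X ^ʳ e · term i)) n             ≡⟨ coeff-sign ℤ.∣ i ∣ (X ^ʳ e · term i) n ⟩
    (-1ℤ ℤ.^ ℤ.∣ i ∣) ℤ.* (X ^ʳ e · term i) n       ≡⟨ ≡.cong ((-1ℤ ℤ.^ ℤ.∣ i ∣) ℤ.*_) (coeff-X^-∸ e (term i) e≤n) ⟩
    (-1ℤ ℤ.^ ℤ.∣ i ∣) ℤ.* term i (n ∸ e)            ∎
    where
    open ≡.≡-Reasoning
    e = quadratic 2 1 i

  gf-pNot : ∀ c d e → gf (allowed M 0 c d) (L * M) (n ∸ e) ≡ + pNot M 0 c d (n ∸ e)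
  gf-pNot c d e = ≡.cong +_ (pNot-partitionCount M 0 c d
    (ℕₚ.≤-trans (ℕₚ.m∸n≤m n e) (ℕₚ.≤-trans (ℕₚ.n≤1+n n) (ℕₚ.m≤m*n L M))))

  summand : ℕ → ℤ
  summand i = (-1ℤ ℤ.^ i) ℤ.*
    ((+ pNot M 0 (k * (3 * m ∸ 3 * i + 2)) (k * (3 * m + 3 * i + 1)) (n ∸ i * (3 * i ∸ 1) / 2))
     ℤ.+ (+ pNot M 0 (k * (3 * m ∸ 3 * i + 1)) (k * (3 * m + 3 * i + 2)) (n ∸ i * (3 * i + 1) / 2)))

  coeff-summands : ∀ q → suc q ≤ m → (pent -[1+ q ] · term -[1+ q ]) n ℤ.+ (pent (+ suc q) · term (+ suc q)) n ≡ summand (suc q)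
  coeff-summands q 1+q≤m = ≡.trans
    (≡.cong₂ ℤ._+_
      (≡.trans (coeff-summand -[1+ q ] (pentagonal⁻ q) (ℕₚ.≤-trans e⁻≤e⁺ e⁺≤n)) (≡.cong ((-1ℤ ℤ.^ suc q) ℤ.*_) (gf-pNot _ _ (suc q * (3 * suc q ∸ 1) / 2))))
      (≡.trans (coeff-summand (+ suc q) (pentagonal⁺ (suc q)) e⁺≤n) (≡.cong ((-1ℤ ℤ.^ suc q) ℤ.*_) (gf-pNot _ _ (suc q * (3 * suc q + 1) / 2)))))
    (≡.sym (ℤₚ.*-distribˡ-+ (-1ℤ ℤ.^ suc q) _ _))
    where
    -- The shifts increase with the index, so the bound on n given for index m covers them all.
    e⁺≤n : suc q * (3 * suc q + 1) / 2 ≤ n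
    e⁺≤n = ℕₚ.≤-trans (/-monoˡ-≤ 2 (ℕₚ.*-mono-≤ 1+q≤m (ℕₚ.+-monoˡ-≤ 1 (ℕₚ.*-monoʳ-≤ 3 1+q≤m)))) pent≤n
    e⁻≤e⁺ : suc q * (3 * suc q ∸ 1) / 2 ≤ suc q * (3 * suc q + 1) / 2
    e⁻≤e⁺ = /-monoˡ-≤ 2 (ℕₚ.*-monoʳ-≤ (suc q) (ℕₚ.≤-trans (ℕₚ.m∸n≤m (3 * suc q) 1) (ℕₚ.m≤m+n (3 * suc q) 1)))

  coeff-Σ± : ∀ l → l ≤ m → Σ± l (λ i → pent i · term i) n ≡ (pent (+ 0) · term (+ 0)) n ℤ.+ sumFrom1 l summand
  coeff-Σ± zero    _ = ≡.trans (coeff (Σ±-zero (λ i → pent i · term i)) n ℕₚ.≤-refl) (≡.sym (ℤₚ.+-identityʳ _))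
  coeff-Σ± (suc l) l<m = ≡.trans (coeff (Σ±-suc l (λ i → pent i · term i)) n ℕₚ.≤-refl)
    (≡.trans (≡.cong₂ ℤ._+_ (coeff-Σ± l (ℕₚ.<⇒≤ l<m)) (coeff-summands l l<m)) (ℤₚ.+-assoc ((pent (+ 0) · term (+ 0)) n) (sumFrom1 l summand) (summand (suc l))))

  -- The constant coefficient of `𝟙` is 1, so n = 0 must be excluded; m ≥ 1 forces n ≥ 2.
  1≤n : 1 ≤ n
  1≤n = ℕₚ.≤-trans (s≤s z≤n) (ℕₚ.≤-trans (/-monoˡ-≤ {1 * (3 * 1 + 1)} 2 (ℕₚ.*-mono-≤ 1≤m (ℕₚ.+-monoˡ-≤ 1 (ℕₚ.*-monoʳ-≤ 3 1≤m)))) pent≤n)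

  recurrence : + 0 ≡ (+ pNot M 0 (k * (3 * m + 1)) (k * (3 * m + 2)) n) ℤ.+ sumFrom1 m summand
  recurrence = begin
    + 0                                                            ≡⟨ 𝟙-positive n 1≤n ⟨
    𝟙 n                                                            ≡⟨ coeff alternatingSum n ℕₚ.≤-refl ⟨
    Σ± m (λ i → pent i · term i) n                                 ≡⟨ coeff-Σ± m ℕₚ.≤-refl ⟩
    (pent (+ 0) · term (+ 0)) n ℤ.+ sumFrom1 m summand             ≡⟨ ≡.cong (ℤ._+ sumFrom1 m summand) first ⟩
    (+ pNot M 0 (k * (3 * m + 1)) (k * (3 * m + 2)) n) ℤ.+ sumFrom1 m summand ∎
    where
    open ≡.≡-Reasoning
    𝟙-positive : ∀ n → 1 ≤ n → 𝟙 n ≡ + 0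
    𝟙-positive (suc n) _ = ≡.refl
    first : (pent (+ 0) · term (+ 0)) n ≡ + pNot M 0 (k * (3 * m + 1)) (k * (3 * m + 2)) n
    first = ≡.trans (coeff-summand (+ 0) {0} ≡.refl z≤n) (≡.trans (ℤₚ.*-identityˡ _) (≡.trans (gf-pNot _ _ 0)
      (≡.cong (λ t → + pNot M 0 (k * (3 * m + 1)) (k * (t + 2)) n) (ℕₚ.+-identityʳ (3 * m)))))

theorem2 : (m n : ℕ) → 1 ≤ m → m * (3 * m + 1) / 2 ≤ n →
    + 0 ≡
    (+ pNot (3 * (2 * m + 1) ^ 2) {{modulusNonZero m}} 0 ((2 * m + 1) * (3 * m + 1)) ((2 * m + 1) * (3 * m + 2)) n)
    ℤ.+ sumFrom1 m (λ i → (-1ℤ ℤ.^ i) ℤ.*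
    ((+ pNot (3 * (2 * m + 1) ^ 2) {{modulusNonZero m}} 0 ((2 * m + 1) * (3 * m ∸ 3 * i + 2)) ((2 * m + 1) * (3 * m + 3 * i + 1))
    (n ∸ i * (3 * i ∸ 1) / 2))
    ℤ.+ (+ pNot (3 * (2 * m + 1) ^ 2) {{modulusNonZero m}} 0 ((2 * m + 1) * (3 * m ∸ 3 * i + 1)) ((2 * m + 1) * (3 * m + 3 * i + 2))
    (n ∸ i * (3 * i + 1) / 2))))
theorem2 = Recurrence.recurrence
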